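{- Let $d\ge 3$ be odd and let $V=(\mathbb{C}^2)^{\otimes d}$. Then for each integer $n\in[0,2^d-2]$ the linear map $$L:\bigwedge^nV\longrightarrow\bigwedge^{n+2}V,\qquad L(v)=\omega\wedge v,$$ where $\omega=\omega_{d,2}$, has full rank (i.e. is injective or surjective).
   Context: The Cayley form for $k=2$ is $$\omega_{d,2}=\sum_{\pi_1,\ldots,\pi_d\in S_2}\mathrm{sgn}(\pi_1\cdots\pi_d)\,\left(e_{\pi_1(1)}\otimes\cdots\otimes e_{\pi_d(1)}\right)\wedge\left(e_{\pi_1(2)}\otimes\cdots\otimes e_{\pi_d(2)}\right)\in\bigwedge^2V,$$ where $e_1,e_2$ is the standard basis of $\mathbb{C}^2$. -}

module Defs where

open import Level using (Level; 0ℓ; _⊔_)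
open import Algebra.Bundles using (CommutativeMonoid; CommutativeRing)
import Algebra.Module.Construct.DirectProduct as DirectProduct
import Algebra.Module.Construct.TensorUnit as TensorUnit
open import Algebra.Module.Bundles using (Module)
open import Algebra.Module.Morphism.Structures using (module ModuleMorphisms)
open import Algebra.Module.Structures.Biased using (IsModuleFromLeft)
import Algebra.Properties.AbelianGroup
import Algebra.Properties.CommutativeSemigroup
import Algebra.Properties.Semiring.Exp
open import Data.Fin.Base as Fin using (Fin; _↑ˡ_; _↑ʳ_)
open import Data.Fin.Patterns using (0F; 1F)
import Data.Fin.Properties as Fin
open import Data.Fin.Permutation using (Permutation′; _⟨$⟩ʳ_; _∘ₚ_; transpose) renaming (id to idₚ)
open import Data.List.Base as List using (List; []; _∷_)
open import Data.Nat.Base as ℕ using (ℕ; zero; suc)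
import Data.Nat.Properties as ℕ
open import Data.Product.Base using (∃; _×_; _,_)
open import Data.Rational.Base as ℚ using (ℚ; 0ℚ; 1ℚ; ½; Positive)
import Data.Rational.Properties as ℚ
open import Data.Rational.Solver using (module +-*-Solver)
open import Data.Sum.Base using (_⊎_)
open import Data.Vec.Base as Vec using (Vec; []; _∷_; _++_; _[_]≔_; lookup)
import Data.Vec.Properties as Vec
open import Data.Vec.Relation.Binary.Pointwise.Inductive as Pointwise using (Pointwise; []; _∷_)
open import Function.Base using (_∘_; flip)
open import Function.Definitions using (Injective; Surjective)
open import Relation.Binary.Core using (Rel)
open import Relation.Binary.PropositionalEquality.Core
  using (_≡_; _≢_; refl; sym; trans; cong; cong₂; subst; subst₂)
open import Relation.Nullary.Decidable using (_×-dec_)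

-- Real numbers are Cauchy sequences of rationals, and _≈ℝ_ identifies sequences
-- whose difference tends to 0. A proof of cauchy or close carries its modulus.
-- Eta is switched off so that comparing two reals never unfolds the moduli.

record ℝ : Set where
  no-eta-equality
  constructor mkℝ
  field
    seq    : ℕ → ℚ
    cauchy : ∀ ε → 0ℚ ℚ.< ε → ∃ λ N → ∀ m n → N ℕ.≤ m → N ℕ.≤ n →
             ℚ.∣ seq m ℚ.- seq n ∣ ℚ.< ε
open ℝ public

infix 4 _≈ℝ_
record _≈ℝ_ (x y : ℝ) : Set where
  constructor mk≈ℝ
  field
    close : ∀ ε → 0ℚ ℚ.< ε → ∃ λ N → ∀ n → N ℕ.≤ n →
            ℚ.∣ seq x n ℚ.- seq y n ∣ ℚ.< ε
open _≈ℝ_ public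

infixl 6 _+ℝ_
infixl 7 _*ℝ_
infix  8 -ℝ_

open +-*-Solver using (solve; _:+_; _:-_; _:*_; :-_; _:=_)

abstract
  swap-≡ : ∀ p q → ℚ.- (p ℚ.- q) ≡ q ℚ.- p
  swap-≡ = solve 2 (λ p q → :- (p :- q) := q :- p) refl

  neg-≡ : ∀ p q → q ℚ.- p ≡ ℚ.- p ℚ.- (ℚ.- q)
  neg-≡ = solve 2 (λ a b → b :- a := (:- a) :- (:- b)) refl

  triangle-≡ : ∀ p q r → (p ℚ.- q) ℚ.+ (q ℚ.- r) ≡ p ℚ.- r
  triangle-≡ = solve 3 (λ p q r → (p :- q) :+ (q :- r) := p :- r) refl

  sum-≡ : ∀ a b c d → (a ℚ.- b) ℚ.+ (c ℚ.- d) ≡ (a ℚ.+ c) ℚ.- (b ℚ.+ d)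
  sum-≡ = solve 4 (λ a b c d → (a :- b) :+ (c :- d) := (a :+ c) :- (b :+ d)) refl

  product-≡ : ∀ a a′ b b′ → a ℚ.* (b ℚ.- b′) ℚ.+ b′ ℚ.* (a ℚ.- a′) ≡ a ℚ.* b ℚ.- a′ ℚ.* b′
  product-≡ = solve 4 (λ a a′ b b′ → a :* (b :- b′) :+ b′ :* (a :- a′) := a :* b :- a′ :* b′) refl

  cancel-≡ : ∀ p q → q ℚ.+ (p ℚ.- q) ≡ p
  cancel-≡ = solve 2 (λ p q → q :+ (p :- q) := p) refl

  re-assoc-≡ : ∀ a b c d e f →
    (a ℚ.* c ℚ.- b ℚ.* d) ℚ.* e ℚ.- (a ℚ.* d ℚ.+ b ℚ.* c) ℚ.* f ≡
    a ℚ.* (c ℚ.* e ℚ.- d ℚ.* f) ℚ.- b ℚ.* (c ℚ.* f ℚ.+ d ℚ.* e)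
  re-assoc-≡ = solve 6 (λ a b c d e f →
    (a :* c :- b :* d) :* e :- (a :* d :+ b :* c) :* f :=
    a :* (c :* e :- d :* f) :- b :* (c :* f :+ d :* e)) refl

  im-assoc-≡ : ∀ a b c d e f →
    (a ℚ.* c ℚ.- b ℚ.* d) ℚ.* f ℚ.+ (a ℚ.* d ℚ.+ b ℚ.* c) ℚ.* e ≡
    a ℚ.* (c ℚ.* f ℚ.+ d ℚ.* e) ℚ.+ b ℚ.* (c ℚ.* e ℚ.- d ℚ.* f)
  im-assoc-≡ = solve 6 (λ a b c d e f →
    (a :* c :- b :* d) :* f :+ (a :* d :+ b :* c) :* e :=
    a :* (c :* f :+ d :* e) :+ b :* (c :* e :- d :* f)) refl

  re-distribˡ-≡ : ∀ a b c d e f →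
    a ℚ.* (c ℚ.+ e) ℚ.- b ℚ.* (d ℚ.+ f) ≡
    (a ℚ.* c ℚ.- b ℚ.* d) ℚ.+ (a ℚ.* e ℚ.- b ℚ.* f)
  re-distribˡ-≡ = solve 6 (λ a b c d e f →
    a :* (c :+ e) :- b :* (d :+ f) :=
    (a :* c :- b :* d) :+ (a :* e :- b :* f)) refl

  im-distribˡ-≡ : ∀ a b c d e f →
    a ℚ.* (d ℚ.+ f) ℚ.+ b ℚ.* (c ℚ.+ e) ≡
    (a ℚ.* d ℚ.+ b ℚ.* c) ℚ.+ (a ℚ.* f ℚ.+ b ℚ.* e)
  im-distribˡ-≡ = solve 6 (λ a b c d e f →
    a :* (d :+ f) :+ b :* (c :+ e) :=
    (a :* d :+ b :* c) :+ (a :* f :+ b :* e)) refl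

  re-comm-≡ : ∀ a b c d → a ℚ.* c ℚ.- b ℚ.* d ≡ c ℚ.* a ℚ.- d ℚ.* b
  re-comm-≡ = solve 4 (λ a b c d → a :* c :- b :* d := c :* a :- d :* b) refl

  im-comm-≡ : ∀ a b c d → a ℚ.* d ℚ.+ b ℚ.* c ≡ c ℚ.* b ℚ.+ d ℚ.* a
  im-comm-≡ = solve 4 (λ a b c d → a :* d :+ b :* c := c :* b :+ d :* a) refl

  re-identityˡ-≡ : ∀ a b → 1ℚ ℚ.* a ℚ.- 0ℚ ℚ.* b ≡ a
  re-identityˡ-≡ a b = trans
    (cong₂ (λ u v → u ℚ.- v) (ℚ.*-identityˡ a) (ℚ.*-zeroˡ b)) (ℚ.+-identityʳ a)

  im-identityˡ-≡ : ∀ a b → 1ℚ ℚ.* b ℚ.+ 0ℚ ℚ.* a ≡ b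
  im-identityˡ-≡ a b = trans
    (cong₂ ℚ._+_ (ℚ.*-identityˡ b) (ℚ.*-zeroˡ a)) (ℚ.+-identityʳ b)

abstract
  half-pos : ∀ {ε} → 0ℚ ℚ.< ε → 0ℚ ℚ.< ½ ℚ.* ε
  half-pos {ε} p = subst (ℚ._< ½ ℚ.* ε) (ℚ.*-zeroʳ ½) (ℚ.*-monoʳ-<-pos ½ p)

  halves : ∀ ε → ½ ℚ.* ε ℚ.+ ½ ℚ.* ε ≡ ε
  halves ε = trans (sym (ℚ.*-distribʳ-+ ε ½ ½)) (ℚ.*-identityˡ ε)

  ∣+∣-half : ∀ {ε} p q → ℚ.∣ p ∣ ℚ.< ½ ℚ.* ε → ℚ.∣ q ∣ ℚ.< ½ ℚ.* ε → ℚ.∣ p ℚ.+ q ∣ ℚ.< ε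
  ∣+∣-half {ε} p q p< q< = subst (ℚ.∣ p ℚ.+ q ∣ ℚ.<_) (halves ε)
    (ℚ.≤-<-trans (ℚ.∣p+q∣≤∣p∣+∣q∣ p q) (ℚ.+-mono-< p< q<))

  ∣-∣-swap : ∀ p q → ℚ.∣ p ℚ.- q ∣ ≡ ℚ.∣ q ℚ.- p ∣
  ∣-∣-swap p q = trans (sym (ℚ.∣-p∣≡∣p∣ (p ℚ.- q)))
    (cong ℚ.∣_∣ (swap-≡ p q))

  triangle-half : ∀ {ε} p q r → ℚ.∣ p ℚ.- q ∣ ℚ.< ½ ℚ.* ε → ℚ.∣ q ℚ.- r ∣ ℚ.< ½ ℚ.* ε →
                  ℚ.∣ p ℚ.- r ∣ ℚ.< ε
  triangle-half {ε} p q r a b = subst (λ z → ℚ.∣ z ∣ ℚ.< ε)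
    (triangle-≡ p q r)
    (∣+∣-half (p ℚ.- q) (q ℚ.- r) a b)

  scale : ∀ {ε} K .{{_ : Positive K}} → 0ℚ ℚ.< ε → ∃ λ δ → 0ℚ ℚ.< δ × K ℚ.* δ ≡ ε
  scale {ε} K p = K⁻¹ ℚ.* ε
    , subst (ℚ._< K⁻¹ ℚ.* ε) (ℚ.*-zeroʳ K⁻¹) (ℚ.*-monoʳ-<-pos K⁻¹ {{ℚ.1/pos⇒pos K}} p)
    , trans (sym (ℚ.*-assoc K K⁻¹ ε))
        (trans (cong (ℚ._* ε) (ℚ.*-inverseʳ K {{K≢0}})) (ℚ.*-identityˡ ε))
    where
    K≢0 : ℚ.NonZero K
    K≢0 = ℚ.pos⇒nonZero K
    K⁻¹ : ℚ
    K⁻¹ = (ℚ.1/ K) {{K≢0}}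

  ∣*∣-bound : ∀ {δ} A .{{_ : Positive A}} a q → ℚ.∣ a ∣ ℚ.≤ A → ℚ.∣ q ∣ ℚ.< δ →
              ℚ.∣ a ℚ.* q ∣ ℚ.< A ℚ.* δ
  ∣*∣-bound {δ} A a q a≤ q< = subst (ℚ._< A ℚ.* δ) (sym (ℚ.∣p*q∣≡∣p∣*∣q∣ a q))
    (ℚ.≤-<-trans (ℚ.*-monoʳ-≤-nonNeg ℚ.∣ q ∣ {{ℚ.∣-∣-nonNeg q}} a≤) (ℚ.*-monoʳ-<-pos A q<))

  products-close : ∀ {ε δ} A B .{{_ : Positive A}} .{{_ : Positive B}} →
    (A ℚ.+ B) ℚ.* δ ≡ ε → ∀ a a′ b b′ → ℚ.∣ a ∣ ℚ.≤ A → ℚ.∣ b′ ∣ ℚ.≤ B →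
    ℚ.∣ a ℚ.- a′ ∣ ℚ.< δ → ℚ.∣ b ℚ.- b′ ∣ ℚ.< δ →
    ℚ.∣ a ℚ.* b ℚ.- a′ ℚ.* b′ ∣ ℚ.< ε
  products-close {ε} {δ} A B eq a a′ b b′ a≤ b≤ a~ b~ =
    subst (λ z → ℚ.∣ z ∣ ℚ.< ε)
      (product-≡ a a′ b b′)
      (subst (ℚ.∣ a ℚ.* (b ℚ.- b′) ℚ.+ b′ ℚ.* (a ℚ.- a′) ∣ ℚ.<_)
        (trans (sym (ℚ.*-distribʳ-+ δ A B)) eq)
        (ℚ.≤-<-trans (ℚ.∣p+q∣≤∣p∣+∣q∣ (a ℚ.* (b ℚ.- b′)) (b′ ℚ.* (a ℚ.- a′)))
          (ℚ.+-mono-< (∣*∣-bound A a _ a≤ b~) (∣*∣-bound B b′ _ b≤ a~))))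

  bounded : ∀ x → ∃ λ B → Positive B × ∃ λ N → ∀ n → N ℕ.≤ n → ℚ.∣ seq x n ∣ ℚ.≤ B
  bounded x with cauchy x 1ℚ (ℚ.positive⁻¹ 1ℚ)
  ... | N , close = ℚ.∣ seq x N ∣ ℚ.+ 1ℚ
    , ℚ.nonNeg+pos⇒pos ℚ.∣ seq x N ∣ {{ℚ.∣-∣-nonNeg (seq x N)}} 1ℚ
    , N , λ n N≤n → subst (λ z → ℚ.∣ z ∣ ℚ.≤ ℚ.∣ seq x N ∣ ℚ.+ 1ℚ)
        (cancel-≡ (seq x n) (seq x N))
        (ℚ.≤-trans (ℚ.∣p+q∣≤∣p∣+∣q∣ (seq x N) (seq x n ℚ.- seq x N))
          (ℚ.+-monoʳ-≤ ℚ.∣ seq x N ∣ (ℚ.<⇒≤ (close n N N≤n ℕ.≤-refl))))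

ratℝ : ℚ → ℝ
ratℝ q = mkℝ (λ _ → q) λ ε ε>0 → 0 , λ _ _ _ _ →
  subst (λ z → ℚ.∣ z ∣ ℚ.< ε) (sym (ℚ.+-inverseʳ q)) ε>0

_+ℝ_ : ℝ → ℝ → ℝ
seq (x +ℝ y) n = seq x n ℚ.+ seq y n
cauchy (x +ℝ y) ε ε>0 with cauchy x (½ ℚ.* ε) (half-pos ε>0) | cauchy y (½ ℚ.* ε) (half-pos ε>0)
... | N , p | N′ , q = N ℕ.⊔ N′ , λ m n m≥ n≥ →
  subst (λ z → ℚ.∣ z ∣ ℚ.< ε)
    (sum-≡ (seq x m) (seq x n) (seq y m) (seq y n))
    (∣+∣-half (seq x m ℚ.- seq x n) (seq y m ℚ.- seq y n) (p m n (ℕ.m⊔n≤o⇒m≤o N N′ m≥) (ℕ.m⊔n≤o⇒m≤o N N′ n≥))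
                  (q m n (ℕ.m⊔n≤o⇒n≤o N N′ m≥) (ℕ.m⊔n≤o⇒n≤o N N′ n≥)))

-ℝ_ : ℝ → ℝ
seq (-ℝ x) n = ℚ.- seq x n
cauchy (-ℝ x) ε ε>0 with cauchy x ε ε>0
... | N , p = N , λ m n m≥ n≥ → subst (λ z → z ℚ.< ε)
  (trans (∣-∣-swap (seq x m) (seq x n)) (cong ℚ.∣_∣
    (neg-≡ (seq x m) (seq x n))))
  (p m n m≥ n≥)

_*ℝ_ : ℝ → ℝ → ℝ
seq (x *ℝ y) n = seq x n ℚ.* seq y n
cauchy (x *ℝ y) ε ε>0 with bounded x | bounded y
... | A , A>0 , M , x≤A | B , B>0 , M′ , y≤B
  with scale (A ℚ.+ B) {{ℚ.pos+pos⇒pos A {{A>0}} B {{B>0}}}} ε>0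
... | δ , δ>0 , eq with cauchy x δ δ>0 | cauchy y δ δ>0
... | N , p | N′ , q = (M ℕ.⊔ M′) ℕ.⊔ (N ℕ.⊔ N′) , λ m n m≥ n≥ →
  products-close A B {{A>0}} {{B>0}} eq (seq x m) (seq x n) (seq y m) (seq y n)
    (x≤A m (ℕ.m⊔n≤o⇒m≤o M M′ (ℕ.m⊔n≤o⇒m≤o (M ℕ.⊔ M′) (N ℕ.⊔ N′) m≥)))
    (y≤B n (ℕ.m⊔n≤o⇒n≤o M M′ (ℕ.m⊔n≤o⇒m≤o (M ℕ.⊔ M′) (N ℕ.⊔ N′) n≥)))
    (p m n (ℕ.m⊔n≤o⇒m≤o N N′ (ℕ.m⊔n≤o⇒n≤o (M ℕ.⊔ M′) (N ℕ.⊔ N′) m≥))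
           (ℕ.m⊔n≤o⇒m≤o N N′ (ℕ.m⊔n≤o⇒n≤o (M ℕ.⊔ M′) (N ℕ.⊔ N′) n≥)))
    (q m n (ℕ.m⊔n≤o⇒n≤o N N′ (ℕ.m⊔n≤o⇒n≤o (M ℕ.⊔ M′) (N ℕ.⊔ N′) m≥))
           (ℕ.m⊔n≤o⇒n≤o N N′ (ℕ.m⊔n≤o⇒n≤o (M ℕ.⊔ M′) (N ℕ.⊔ N′) n≥)))

abstract
  pointwise : ∀ {x y} → (∀ n → seq x n ≡ seq y n) → x ≈ℝ y
  pointwise {x} {y} x≡y .close ε ε>0 = 0 , λ n _ → subst (λ z → ℚ.∣ z ∣ ℚ.< ε)
    (sym (trans (cong (ℚ._- seq y n) (x≡y n)) (ℚ.+-inverseʳ (seq y n)))) ε>0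

  ≈ℝ-sym : ∀ {x y} → x ≈ℝ y → y ≈ℝ x
  ≈ℝ-sym {x} {y} p .close ε ε>0 with p .close ε ε>0
  ... | N , h = N , λ n N≤n → subst (ℚ._< ε) (∣-∣-swap (seq x n) (seq y n)) (h n N≤n)

  ≈ℝ-trans : ∀ {x y z} → x ≈ℝ y → y ≈ℝ z → x ≈ℝ z
  ≈ℝ-trans {x} {y} {z} p q .close ε ε>0 with p .close (½ ℚ.* ε) (half-pos ε>0) | q .close (½ ℚ.* ε) (half-pos ε>0)
  ... | N , h | N′ , k = N ℕ.⊔ N′ , λ n n≥ → triangle-half (seq x n) (seq y n) (seq z n)
    (h n (ℕ.m⊔n≤o⇒m≤o N N′ n≥)) (k n (ℕ.m⊔n≤o⇒n≤o N N′ n≥))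

  +ℝ-cong : ∀ {x x′ y y′} → x ≈ℝ x′ → y ≈ℝ y′ → x +ℝ y ≈ℝ x′ +ℝ y′
  +ℝ-cong {x} {x′} {y} {y′} p q .close ε ε>0
    with p .close (½ ℚ.* ε) (half-pos ε>0) | q .close (½ ℚ.* ε) (half-pos ε>0)
  ... | N , h | N′ , k = N ℕ.⊔ N′ , λ n n≥ →
    subst (λ z → ℚ.∣ z ∣ ℚ.< ε)
      (sum-≡ (seq x n) (seq x′ n) (seq y n) (seq y′ n))
      (∣+∣-half (seq x n ℚ.- seq x′ n) (seq y n ℚ.- seq y′ n) (h n (ℕ.m⊔n≤o⇒m≤o N N′ n≥)) (k n (ℕ.m⊔n≤o⇒n≤o N N′ n≥)))

  -ℝ-cong : ∀ {x y} → x ≈ℝ y → -ℝ x ≈ℝ -ℝ y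
  -ℝ-cong {x} {y} p .close ε ε>0 with p .close ε ε>0
  ... | N , h = N , λ n n≥ → subst (λ z → z ℚ.< ε)
    (trans (∣-∣-swap (seq x n) (seq y n)) (cong ℚ.∣_∣
      (neg-≡ (seq x n) (seq y n))))
    (h n n≥)

  *-close : ∀ {x x′ y y′ : ℕ → ℚ} →
    (∃ λ A → Positive A × ∃ λ N → ∀ n → N ℕ.≤ n → ℚ.∣ x n ∣ ℚ.≤ A) →
    (∃ λ B → Positive B × ∃ λ N → ∀ n → N ℕ.≤ n → ℚ.∣ y′ n ∣ ℚ.≤ B) →
    (∀ ε → 0ℚ ℚ.< ε → ∃ λ N → ∀ n → N ℕ.≤ n → ℚ.∣ x n ℚ.- x′ n ∣ ℚ.< ε) →
    (∀ ε → 0ℚ ℚ.< ε → ∃ λ N → ∀ n → N ℕ.≤ n → ℚ.∣ y n ℚ.- y′ n ∣ ℚ.< ε) →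
    ∀ ε → 0ℚ ℚ.< ε →
    ∃ λ N → ∀ n → N ℕ.≤ n → ℚ.∣ x n ℚ.* y n ℚ.- x′ n ℚ.* y′ n ∣ ℚ.< ε
  *-close {x} {x′} {y} {y′} (A , A>0 , M , x≤A) (B , B>0 , M′ , y≤B) x≈ y≈ ε ε>0
    with scale (A ℚ.+ B) {{ℚ.pos+pos⇒pos A {{A>0}} B {{B>0}}}} ε>0
  ... | δ , δ>0 , eq with x≈ δ δ>0 | y≈ δ δ>0
  ... | N , p | N′ , q = (M ℕ.⊔ M′) ℕ.⊔ (N ℕ.⊔ N′) , λ n n≥ →
    products-close A B {{A>0}} {{B>0}} eq (x n) (x′ n) (y n) (y′ n)
      (x≤A n (ℕ.m⊔n≤o⇒m≤o M M′ (ℕ.m⊔n≤o⇒m≤o (M ℕ.⊔ M′) (N ℕ.⊔ N′) n≥)))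
      (y≤B n (ℕ.m⊔n≤o⇒n≤o M M′ (ℕ.m⊔n≤o⇒m≤o (M ℕ.⊔ M′) (N ℕ.⊔ N′) n≥)))
      (p n (ℕ.m⊔n≤o⇒m≤o N N′ (ℕ.m⊔n≤o⇒n≤o (M ℕ.⊔ M′) (N ℕ.⊔ N′) n≥)))
      (q n (ℕ.m⊔n≤o⇒n≤o N N′ (ℕ.m⊔n≤o⇒n≤o (M ℕ.⊔ M′) (N ℕ.⊔ N′) n≥)))

  *ℝ-cong : ∀ {x x′ y y′} → x ≈ℝ x′ → y ≈ℝ y′ → x *ℝ y ≈ℝ x′ *ℝ y′
  *ℝ-cong {x} {x′} {y} {y′} x≈ y≈ .close =
    *-close {seq x} {seq x′} {seq y} {seq y′} (bounded x) (bounded y′) (close x≈) (close y≈)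

≈ℝ-refl : ∀ {x} → x ≈ℝ x
≈ℝ-refl = pointwise (λ _ → refl)

record ℂ : Set where
  constructor _+i_
  field
    re im : ℝ
open ℂ public

infix 4 _≈ℂ_
record _≈ℂ_ (z w : ℂ) : Set where
  constructor mk≈ℂ
  field
    re-≈ : re z ≈ℝ re w
    im-≈ : im z ≈ℝ im w
open _≈ℂ_ public

infixl 6 _+ℂ_
infixl 7 _*ℂ_
infix  8 -ℂ_

_+ℂ_ : ℂ → ℂ → ℂ
z +ℂ w = (re z +ℝ re w) +i (im z +ℝ im w)

-ℂ_ : ℂ → ℂ
-ℂ z = (-ℝ re z) +i (-ℝ im z)

_*ℂ_ : ℂ → ℂ → ℂ
z *ℂ w = (re z *ℝ re w +ℝ -ℝ (im z *ℝ im w)) +i (re z *ℝ im w +ℝ im z *ℝ re w)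

ratℂ : ℚ → ℂ
ratℂ q = ratℝ q +i ratℝ 0ℚ

abstract
  ≈ℂ-trans : ∀ {x y z} → x ≈ℂ y → y ≈ℂ z → x ≈ℂ z
  ≈ℂ-trans p q = mk≈ℂ (≈ℝ-trans (re-≈ p) (re-≈ q)) (≈ℝ-trans (im-≈ p) (im-≈ q))

  +ℂ-cong : ∀ {x x′ y y′} → x ≈ℂ x′ → y ≈ℂ y′ → x +ℂ y ≈ℂ x′ +ℂ y′
  +ℂ-cong p q = mk≈ℂ (+ℝ-cong (re-≈ p) (re-≈ q)) (+ℝ-cong (im-≈ p) (im-≈ q))

  -ℂ-cong : ∀ {x y} → x ≈ℂ y → -ℂ x ≈ℂ -ℂ y
  -ℂ-cong p = mk≈ℂ (-ℝ-cong (re-≈ p)) (-ℝ-cong (im-≈ p))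

  *ℂ-cong : ∀ {x x′ y y′} → x ≈ℂ x′ → y ≈ℂ y′ → x *ℂ y ≈ℂ x′ *ℂ y′
  *ℂ-cong p q = mk≈ℂ
    (+ℝ-cong (*ℝ-cong (re-≈ p) (re-≈ q)) (-ℝ-cong (*ℝ-cong (im-≈ p) (im-≈ q))))
    (+ℝ-cong (*ℝ-cong (re-≈ p) (im-≈ q)) (*ℝ-cong (im-≈ p) (re-≈ q)))

  +ℂ-assoc : ∀ x y z → (x +ℂ y) +ℂ z ≈ℂ x +ℂ (y +ℂ z)
  +ℂ-assoc x y z = mk≈ℂ
    (pointwise λ n → ℚ.+-assoc (seq (re x) n) (seq (re y) n) (seq (re z) n))
    (pointwise λ n → ℚ.+-assoc (seq (im x) n) (seq (im y) n) (seq (im z) n))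

  +ℂ-comm : ∀ x y → x +ℂ y ≈ℂ y +ℂ x
  +ℂ-comm x y = mk≈ℂ
    (pointwise λ n → ℚ.+-comm (seq (re x) n) (seq (re y) n))
    (pointwise λ n → ℚ.+-comm (seq (im x) n) (seq (im y) n))

  +ℂ-identityˡ : ∀ x → ratℂ 0ℚ +ℂ x ≈ℂ x
  +ℂ-identityˡ x = mk≈ℂ
    (pointwise λ n → ℚ.+-identityˡ (seq (re x) n))
    (pointwise λ n → ℚ.+-identityˡ (seq (im x) n))

  -ℂ-inverseˡ : ∀ x → -ℂ x +ℂ x ≈ℂ ratℂ 0ℚ
  -ℂ-inverseˡ x = mk≈ℂ
    (pointwise λ n → ℚ.+-inverseˡ (seq (re x) n))
    (pointwise λ n → ℚ.+-inverseˡ (seq (im x) n))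

  *ℂ-assoc : ∀ x y z → (x *ℂ y) *ℂ z ≈ℂ x *ℂ (y *ℂ z)
  *ℂ-assoc x y z = mk≈ℂ
    (pointwise λ n → re-assoc-≡ (seq (re x) n) (seq (im x) n) (seq (re y) n)
                                (seq (im y) n) (seq (re z) n) (seq (im z) n))
    (pointwise λ n → im-assoc-≡ (seq (re x) n) (seq (im x) n) (seq (re y) n)
                                (seq (im y) n) (seq (re z) n) (seq (im z) n))

  *ℂ-comm : ∀ x y → x *ℂ y ≈ℂ y *ℂ x
  *ℂ-comm x y = mk≈ℂ
    (pointwise λ n → re-comm-≡ (seq (re x) n) (seq (im x) n) (seq (re y) n) (seq (im y) n))
    (pointwise λ n → im-comm-≡ (seq (re x) n) (seq (im x) n) (seq (re y) n) (seq (im y) n))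

  *ℂ-identityˡ : ∀ x → ratℂ 1ℚ *ℂ x ≈ℂ x
  *ℂ-identityˡ x = mk≈ℂ
    (pointwise λ n → re-identityˡ-≡ (seq (re x) n) (seq (im x) n))
    (pointwise λ n → im-identityˡ-≡ (seq (re x) n) (seq (im x) n))

  *ℂ-distribˡ : ∀ x y z → x *ℂ (y +ℂ z) ≈ℂ x *ℂ y +ℂ x *ℂ z
  *ℂ-distribˡ x y z = mk≈ℂ
    (pointwise λ n → re-distribˡ-≡ (seq (re x) n) (seq (im x) n) (seq (re y) n)
                                   (seq (im y) n) (seq (re z) n) (seq (im z) n))
    (pointwise λ n → im-distribˡ-≡ (seq (re x) n) (seq (im x) n) (seq (re y) n)
                                   (seq (im y) n) (seq (re z) n) (seq (im z) n))

ℂ-commutativeRing : CommutativeRing 0ℓ 0ℓ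
ℂ-commutativeRing = record
  { Carrier = ℂ
  ; _≈_ = _≈ℂ_
  ; _+_ = _+ℂ_
  ; _*_ = _*ℂ_
  ; -_ = -ℂ_
  ; 0# = ratℂ 0ℚ
  ; 1# = ratℂ 1ℚ
  ; isCommutativeRing = record
    { isRing = record
      { +-isAbelianGroup = record
        { isGroup = record
          { isMonoid = record
            { isSemigroup = record
              { isMagma = record
                { isEquivalence = record
                  { refl = mk≈ℂ ≈ℝ-refl ≈ℝ-refl
                  ; sym = λ p → mk≈ℂ (≈ℝ-sym (re-≈ p)) (≈ℝ-sym (im-≈ p))
                  ; trans = ≈ℂ-trans
                  }
                ; ∙-cong = +ℂ-cong
                }
              ; assoc = +ℂ-assoc
              }
            ; identity = +ℂ-identityˡ
              , λ x → ≈ℂ-trans (+ℂ-comm x (ratℂ 0ℚ)) (+ℂ-identityˡ x)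
            }
          ; inverse = -ℂ-inverseˡ
            , λ x → ≈ℂ-trans (+ℂ-comm x (-ℂ x)) (-ℂ-inverseˡ x)
          ; ⁻¹-cong = -ℂ-cong
          }
        ; comm = +ℂ-comm
        }
      ; *-cong = *ℂ-cong
      ; *-assoc = *ℂ-assoc
      ; *-identity = *ℂ-identityˡ
        , λ x → ≈ℂ-trans (*ℂ-comm x (ratℂ 1ℚ)) (*ℂ-identityˡ x)
      ; distrib = *ℂ-distribˡ
        , λ x y z → ≈ℂ-trans (*ℂ-comm (y +ℂ z) x)
            (≈ℂ-trans (*ℂ-distribˡ x y z) (+ℂ-cong (*ℂ-comm x y) (*ℂ-comm x z)))
      }
    ; *-comm = *ℂ-comm
    }
  }

inversions : ∀ {k} → Permutation′ k → ℕ
inversions {k} π = List.length (List.filter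
  (λ (i , j) → (i Fin.<? j) ×-dec ((π ⟨$⟩ʳ j) Fin.<? (π ⟨$⟩ʳ i)))
  (List.cartesianProduct (List.allFin k) (List.allFin k)))

S₂ : List (Permutation′ 2)
S₂ = idₚ ∷ transpose 0F 1F ∷ []

-- _∘ₚ_ applies its left argument first, whereas π₁π₂⋯π_d applies π_d first.
∏ₚ : ∀ {k d} → Vec (Permutation′ k) d → Permutation′ k
∏ₚ = Vec.foldr _ (λ π ρ → ρ ∘ₚ π) idₚ

tuples : ∀ {a} {A : Set a} → List A → ∀ d → List (Vec A d)
tuples xs zero    = [] ∷ []
tuples xs (suc d) = List.cartesianProductWith _∷_ xs (tuples xs d)

module Multilinear {c ℓ : Level} (R : CommutativeRing c ℓ) where

  open CommutativeRing R using (_≈_; _+_; _*_; -_; 0#; 1#; semiring; *-comm)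
    renaming (Carrier to A; refl to ≈-refl)
  open Algebra.Properties.Semiring.Exp semiring using (_^_)
  open Module using (Carrierᴹ; rawModule)

  record LinearMap {m ℓm n ℓn : Level} (M : Module R m ℓm) (N : Module R n ℓn) :
                   Set (c ⊔ m ⊔ ℓm ⊔ n ⊔ ℓn) where
    field
      ⟦_⟧ : Carrierᴹ M → Carrierᴹ N
      isModuleHomomorphism :
        ModuleMorphisms.IsModuleHomomorphism (rawModule M) (rawModule N) ⟦_⟧

  FullRank : ∀ {m ℓm n ℓn : Level} {M : Module R m ℓm} {N : Module R n ℓn} →
             LinearMap M N → Set (m ⊔ ℓm ⊔ n ⊔ ℓn)
  FullRank {M = M} {N = N} f =
    Injective (Module._≈ᴹ_ M) (Module._≈ᴹ_ N) (LinearMap.⟦_⟧ f) ⊎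
    Surjective (Module._≈ᴹ_ M) (Module._≈ᴹ_ N) (LinearMap.⟦_⟧ f)

  infixl 6 _⊕_
  infixr 7 _⊙_
  infixr 8 ⊖_

  data Free {x : Level} (X : Set x) : Set (c ⊔ x) where
    ⟨_⟩ : X → Free X
    𝟘   : Free X
    _⊕_ : Free X → Free X → Free X
    ⊖_  : Free X → Free X
    _⊙_ : A → Free X → Free X

  mapFree : ∀ {x y : Level} {X : Set x} {Y : Set y} → (X → Y) → Free X → Free Y
  mapFree f ⟨ x ⟩   = ⟨ f x ⟩
  mapFree f 𝟘       = 𝟘
  mapFree f (s ⊕ t) = mapFree f s ⊕ mapFree f t
  mapFree f (⊖ s)   = ⊖ mapFree f s
  mapFree f (a ⊙ s) = a ⊙ mapFree f s

  data Generated {x ρ : Level} {X : Set x} (_~_ : Rel (Free X) ρ) :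
                 Rel (Free X) (c ⊔ ℓ ⊔ x ⊔ ρ) where
    rel          : ∀ {s t} → s ~ t → Generated _~_ s t
    reflexive    : ∀ {s} → Generated _~_ s s
    symmetric    : ∀ {s t} → Generated _~_ s t → Generated _~_ t s
    transitive   : ∀ {s t u} → Generated _~_ s t → Generated _~_ t u → Generated _~_ s u
    ⊕-cong       : ∀ {s s′ t t′} → Generated _~_ s s′ → Generated _~_ t t′ →
                   Generated _~_ (s ⊕ t) (s′ ⊕ t′)
    ⊖-cong       : ∀ {s t} → Generated _~_ s t → Generated _~_ (⊖ s) (⊖ t)
    ⊙-cong       : ∀ {a b s t} → a ≈ b → Generated _~_ s t → Generated _~_ (a ⊙ s) (b ⊙ t)
    ⊕-assoc      : ∀ s t u → Generated _~_ ((s ⊕ t) ⊕ u) (s ⊕ (t ⊕ u))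
    ⊕-comm       : ∀ s t → Generated _~_ (s ⊕ t) (t ⊕ s)
    ⊕-identityˡ  : ∀ s → Generated _~_ (𝟘 ⊕ s) s
    ⊖-inverseˡ   : ∀ s → Generated _~_ (⊖ s ⊕ s) 𝟘
    ⊙-zeroˡ      : ∀ s → Generated _~_ (0# ⊙ s) 𝟘
    ⊙-zeroʳ      : ∀ a → Generated _~_ (a ⊙ 𝟘) 𝟘
    ⊙-identityˡ  : ∀ s → Generated _~_ (1# ⊙ s) s
    ⊙-assoc      : ∀ a b s → Generated _~_ ((a * b) ⊙ s) (a ⊙ (b ⊙ s))
    ⊙-distribˡ   : ∀ a s t → Generated _~_ (a ⊙ (s ⊕ t)) (a ⊙ s ⊕ a ⊙ t)
    ⊙-distribʳ   : ∀ s a b → Generated _~_ ((a + b) ⊙ s) (a ⊙ s ⊕ b ⊙ s)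

  -- Free X consists of formal linear combinations before any module law is
  -- imposed; with Generated _~_ as its equality it is the free module on X modulo
  -- the submodule generated by the differences s - t with s ~ t.
  Free/ : ∀ {x ρ : Level} {X : Set x} → Rel (Free X) ρ → Module R (c ⊔ x) (c ⊔ ℓ ⊔ x ⊔ ρ)
  Free/ {X = X} _~_ = record
    { Carrierᴹ = Free X
    ; _≈ᴹ_ = Generated _~_
    ; _+ᴹ_ = _⊕_
    ; _*ₗ_ = _⊙_
    ; _*ᵣ_ = flip _⊙_
    ; 0ᴹ = 𝟘
    ; -ᴹ_ = ⊖_
    ; isModule = IsModuleFromLeft.isModule {commutativeRing = R} record
      { isLeftModule = record
        { isLeftSemimodule = record
          { +ᴹ-isCommutativeMonoid = record
            { isMonoid = record
              { isSemigroup = record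
                { isMagma = record
                  { isEquivalence = record
                    { refl = reflexive ; sym = symmetric ; trans = transitive }
                  ; ∙-cong = ⊕-cong
                  }
                ; assoc = ⊕-assoc
                }
              ; identity = ⊕-identityˡ
                , λ s → transitive (⊕-comm s 𝟘) (⊕-identityˡ s)
              }
            ; comm = ⊕-comm
            }
          ; isPreleftSemimodule = record
            { *ₗ-cong = ⊙-cong
            ; *ₗ-zeroˡ = ⊙-zeroˡ
            ; *ₗ-distribʳ = ⊙-distribʳ
            ; *ₗ-identityˡ = ⊙-identityˡ
            ; *ₗ-assoc = ⊙-assoc
            ; *ₗ-zeroʳ = ⊙-zeroʳ
            ; *ₗ-distribˡ = ⊙-distribˡ
            }
          }
        ; -ᴹ‿cong = ⊖-cong
        ; -ᴹ‿inverse = ⊖-inverseˡ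
          , λ s → transitive (⊕-comm s (⊖ s)) (⊖-inverseˡ s)
        }
      }
    }

  mapFree-cong : ∀ {x y ρ σ : Level} {X : Set x} {Y : Set y}
    {_~_ : Rel (Free X) ρ} {_≃_ : Rel (Free Y) σ} (f : X → Y) →
    (∀ {s t} → s ~ t → Generated _≃_ (mapFree f s) (mapFree f t)) →
    ∀ {s t} → Generated _~_ s t → Generated _≃_ (mapFree f s) (mapFree f t)
  mapFree-cong f h (rel p)           = h p
  mapFree-cong f h reflexive         = reflexive
  mapFree-cong f h (symmetric p)     = symmetric (mapFree-cong f h p)
  mapFree-cong f h (transitive p q)  = transitive (mapFree-cong f h p) (mapFree-cong f h q)
  mapFree-cong f h (⊕-cong p q)      = ⊕-cong (mapFree-cong f h p) (mapFree-cong f h q)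
  mapFree-cong f h (⊖-cong p)        = ⊖-cong (mapFree-cong f h p)
  mapFree-cong f h (⊙-cong a p)      = ⊙-cong a (mapFree-cong f h p)
  mapFree-cong f h (⊕-assoc s t u)   = ⊕-assoc _ _ _
  mapFree-cong f h (⊕-comm s t)      = ⊕-comm _ _
  mapFree-cong f h (⊕-identityˡ s)   = ⊕-identityˡ _
  mapFree-cong f h (⊖-inverseˡ s)    = ⊖-inverseˡ _
  mapFree-cong f h (⊙-zeroˡ s)       = ⊙-zeroˡ _
  mapFree-cong f h (⊙-zeroʳ a)       = ⊙-zeroʳ a
  mapFree-cong f h (⊙-identityˡ s)   = ⊙-identityˡ _
  mapFree-cong f h (⊙-assoc a b s)   = ⊙-assoc a b _
  mapFree-cong f h (⊙-distribˡ a s t) = ⊙-distribˡ a _ _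
  mapFree-cong f h (⊙-distribʳ s a b) = ⊙-distribʳ _ a b

  module _ {m ℓm : Level} (M : Module R m ℓm) where

    open Module M using (_≈ᴹ_; _+ᴹ_; _*ₗ_)

    data MultilinearRel {n : ℕ} : Rel (Free (Vec (Carrierᴹ M) n)) (c ⊔ m ⊔ ℓm) where
      congruent   : ∀ {u v} → Pointwise _≈ᴹ_ u v → MultilinearRel ⟨ u ⟩ ⟨ v ⟩
      additive    : ∀ v i x y →
        MultilinearRel ⟨ v [ i ]≔ (x +ᴹ y) ⟩ (⟨ v [ i ]≔ x ⟩ ⊕ ⟨ v [ i ]≔ y ⟩)
      homogeneous : ∀ v i a x →
        MultilinearRel ⟨ v [ i ]≔ (a *ₗ x) ⟩ (a ⊙ ⟨ v [ i ]≔ x ⟩)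

    data AlternatingRel {n : ℕ} : Rel (Free (Vec (Carrierᴹ M) n)) (c ⊔ m ⊔ ℓm) where
      multilinear : ∀ {s t} → MultilinearRel s t → AlternatingRel s t
      repeated    : ∀ v i j → i ≢ j → lookup v i ≈ᴹ lookup v j → AlternatingRel ⟨ v ⟩ 𝟘

  ⨂ : ∀ {m ℓm : Level} → ℕ → Module R m ℓm → Module R (c ⊔ m) (c ⊔ ℓ ⊔ m ⊔ ℓm)
  ⨂ n M = Free/ (MultilinearRel M {n})

  ⋀ : ∀ {m ℓm : Level} → ℕ → Module R m ℓm → Module R (c ⊔ m) (c ⊔ ℓ ⊔ m ⊔ ℓm)
  ⋀ n M = Free/ (AlternatingRel M {n})

  infixl 7 _∧_

  _∧_ : ∀ {b : Level} {B : Set b} {p q : ℕ} →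
        Free (Vec B p) → Free (Vec B q) → Free (Vec B (p ℕ.+ q))
  ⟨ u ⟩   ∧ t = mapFree (u ++_) t
  𝟘       ∧ t = 𝟘
  (s ⊕ r) ∧ t = (s ∧ t) ⊕ (r ∧ t)
  (⊖ s)   ∧ t = ⊖ (s ∧ t)
  (a ⊙ s) ∧ t = a ⊙ (s ∧ t)

  ∧-⟨⟩ : ∀ {b : Level} {B : Set b} {p q : ℕ} (s : Free (Vec B p)) (v : Vec B q) →
         s ∧ ⟨ v ⟩ ≡ mapFree (_++ v) s
  ∧-⟨⟩ ⟨ u ⟩   v = refl
  ∧-⟨⟩ 𝟘       v = refl
  ∧-⟨⟩ (s ⊕ r) v = cong₂ _⊕_ (∧-⟨⟩ s v) (∧-⟨⟩ r v)
  ∧-⟨⟩ (⊖ s)   v = cong ⊖_ (∧-⟨⟩ s v)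
  ∧-⟨⟩ (a ⊙ s) v = cong (a ⊙_) (∧-⟨⟩ s v)

  module _ {m ℓm : Level} (M : Module R m ℓm) (p q : ℕ) where

    private
      module P = Module (⋀ p M)
      module Q = Module (⋀ q M)
      module PQ = Module (⋀ (p ℕ.+ q) M)
      module PQ-group = Algebra.Properties.AbelianGroup PQ.+ᴹ-abelianGroup
      module PQ-semigroup = Algebra.Properties.CommutativeSemigroup
        (CommutativeMonoid.commutativeSemigroup PQ.+ᴹ-commutativeMonoid)
      open Module M using (_≈ᴹ_; ≈ᴹ-refl)

      ++ʳ-resp : ∀ u {s t : Free (Vec (Carrierᴹ M) q)} → AlternatingRel M s t →
                 mapFree {Y = Vec (Carrierᴹ M) (p ℕ.+ q)} (u ++_) s PQ.≈ᴹ mapFree (u ++_) t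
      ++ʳ-resp u (multilinear (congruent vs)) =
        rel (multilinear (congruent (Pointwise.++⁺ (Pointwise.refl ≈ᴹ-refl {u}) vs)))
      ++ʳ-resp u (multilinear (additive v i x y))
        rewrite sym (Vec.[]≔-++-↑ʳ {y = Module._+ᴹ_ M x y} u v i)
              | sym (Vec.[]≔-++-↑ʳ {y = x} u v i)
              | sym (Vec.[]≔-++-↑ʳ {y = y} u v i) =
        rel (multilinear (additive (u ++ v) (p ↑ʳ i) x y))
      ++ʳ-resp u (multilinear (homogeneous v i a x))
        rewrite sym (Vec.[]≔-++-↑ʳ {y = Module._*ₗ_ M a x} u v i)
              | sym (Vec.[]≔-++-↑ʳ {y = x} u v i) =
        rel (multilinear (homogeneous (u ++ v) (p ↑ʳ i) a x))
      ++ʳ-resp u (repeated v i j i≢j eq) =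
        rel (repeated (u ++ v) (p ↑ʳ i) (p ↑ʳ j) (i≢j ∘ Fin.↑ʳ-injective p i j)
          (subst₂ _≈ᴹ_ (sym (Vec.lookup-++ʳ u v i)) (sym (Vec.lookup-++ʳ u v j)) eq))

      ++ˡ-resp : ∀ v {s t : Free (Vec (Carrierᴹ M) p)} → AlternatingRel M s t →
                 mapFree {Y = Vec (Carrierᴹ M) (p ℕ.+ q)} (_++ v) s PQ.≈ᴹ mapFree (_++ v) t
      ++ˡ-resp v (multilinear (congruent us)) =
        rel (multilinear (congruent (Pointwise.++⁺ us (Pointwise.refl ≈ᴹ-refl {v}))))
      ++ˡ-resp v (multilinear (additive u i x y))
        rewrite sym (Vec.[]≔-++-↑ˡ {x = Module._+ᴹ_ M x y} u v i)
              | sym (Vec.[]≔-++-↑ˡ {x = x} u v i)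
              | sym (Vec.[]≔-++-↑ˡ {x = y} u v i) =
        rel (multilinear (additive (u ++ v) (i ↑ˡ q) x y))
      ++ˡ-resp v (multilinear (homogeneous u i a x))
        rewrite sym (Vec.[]≔-++-↑ˡ {x = Module._*ₗ_ M a x} u v i)
              | sym (Vec.[]≔-++-↑ˡ {x = x} u v i) =
        rel (multilinear (homogeneous (u ++ v) (i ↑ˡ q) a x))
      ++ˡ-resp v (repeated u i j i≢j eq) =
        rel (repeated (u ++ v) (i ↑ˡ q) (j ↑ˡ q) (i≢j ∘ Fin.↑ˡ-injective q i j)
          (subst₂ _≈ᴹ_ (sym (Vec.lookup-++ˡ u v i)) (sym (Vec.lookup-++ˡ u v j)) eq))

    ∧-zeroʳ : ∀ (s : P.Carrierᴹ) → s ∧ 𝟘 PQ.≈ᴹ 𝟘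
    ∧-zeroʳ ⟨ u ⟩   = reflexive
    ∧-zeroʳ 𝟘       = reflexive
    ∧-zeroʳ (s ⊕ r) = transitive (⊕-cong (∧-zeroʳ s) (∧-zeroʳ r)) (⊕-identityˡ 𝟘)
    ∧-zeroʳ (⊖ s)   = transitive (⊖-cong (∧-zeroʳ s)) PQ-group.ε⁻¹≈ε
    ∧-zeroʳ (a ⊙ s) = transitive (⊙-cong ≈-refl (∧-zeroʳ s)) (⊙-zeroʳ a)

    ∧-distribˡ : ∀ (s : P.Carrierᴹ) (t t′ : Q.Carrierᴹ) → s ∧ (t ⊕ t′) PQ.≈ᴹ (s ∧ t) ⊕ (s ∧ t′)
    ∧-distribˡ ⟨ u ⟩   t t′ = reflexive
    ∧-distribˡ 𝟘       t t′ = symmetric (⊕-identityˡ 𝟘)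
    ∧-distribˡ (s ⊕ r) t t′ = transitive
      (⊕-cong (∧-distribˡ s t t′) (∧-distribˡ r t t′))
      (PQ-semigroup.interchange (s ∧ t) (s ∧ t′) (r ∧ t) (r ∧ t′))
    ∧-distribˡ (⊖ s)   t t′ = transitive (⊖-cong (∧-distribˡ s t t′))
      (symmetric (PQ-group.⁻¹-∙-comm (s ∧ t) (s ∧ t′)))
    ∧-distribˡ (a ⊙ s) t t′ = transitive (⊙-cong ≈-refl (∧-distribˡ s t t′))
      (⊙-distribˡ a (s ∧ t) (s ∧ t′))

    ∧-⊖ : ∀ (s : P.Carrierᴹ) (t : Q.Carrierᴹ) → s ∧ (⊖ t) PQ.≈ᴹ ⊖ (s ∧ t)
    ∧-⊖ s t = PQ-group.inverseˡ-unique (s ∧ (⊖ t)) (s ∧ t)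
      (transitive (symmetric (∧-distribˡ s (⊖ t) t))
        (transitive (helper s) (∧-zeroʳ s)))
      where
      helper : ∀ (s : P.Carrierᴹ) → s ∧ (⊖ t ⊕ t) PQ.≈ᴹ s ∧ 𝟘
      helper ⟨ u ⟩   = ⊖-inverseˡ (mapFree (u ++_) t)
      helper 𝟘       = reflexive
      helper (s ⊕ r) = ⊕-cong (helper s) (helper r)
      helper (⊖ s)   = ⊖-cong (helper s)
      helper (a ⊙ s) = ⊙-cong ≈-refl (helper s)

    ∧-⊙ : ∀ (s : P.Carrierᴹ) a (t : Q.Carrierᴹ) → s ∧ (a ⊙ t) PQ.≈ᴹ a ⊙ (s ∧ t)
    ∧-⊙ ⟨ u ⟩   a t = reflexive
    ∧-⊙ 𝟘       a t = symmetric (⊙-zeroʳ a)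
    ∧-⊙ (s ⊕ r) a t = transitive (⊕-cong (∧-⊙ s a t) (∧-⊙ r a t))
      (symmetric (⊙-distribˡ a (s ∧ t) (r ∧ t)))
    ∧-⊙ (⊖ s)   a t = transitive (⊖-cong (∧-⊙ s a t)) (symmetric
      (PQ-group.inverseˡ-unique (a ⊙ (⊖ (s ∧ t))) (a ⊙ (s ∧ t))
        (transitive (symmetric (⊙-distribˡ a (⊖ (s ∧ t)) (s ∧ t)))
          (transitive (⊙-cong ≈-refl (⊖-inverseˡ (s ∧ t))) (⊙-zeroʳ a)))))
    ∧-⊙ (b ⊙ s) a t = transitive (⊙-cong ≈-refl (∧-⊙ s a t))
      (transitive (symmetric (⊙-assoc b a (s ∧ t)))
        (transitive (⊙-cong (*-comm b a) reflexive) (⊙-assoc a b (s ∧ t))))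

    ∧-congˡ : ∀ (s : P.Carrierᴹ) {t t′ : Q.Carrierᴹ} → t Q.≈ᴹ t′ → s ∧ t PQ.≈ᴹ s ∧ t′
    ∧-congˡ ⟨ u ⟩   eq = mapFree-cong (u ++_) (++ʳ-resp u) eq
    ∧-congˡ 𝟘       eq = reflexive
    ∧-congˡ (s ⊕ r) eq = ⊕-cong (∧-congˡ s eq) (∧-congˡ r eq)
    ∧-congˡ (⊖ s)   eq = ⊖-cong (∧-congˡ s eq)
    ∧-congˡ (a ⊙ s) eq = ⊙-cong ≈-refl (∧-congˡ s eq)

    ∧-congʳ : ∀ {s s′ : P.Carrierᴹ} → s P.≈ᴹ s′ → ∀ (t : Q.Carrierᴹ) → s ∧ t PQ.≈ᴹ s′ ∧ t
    ∧-congʳ {s} {s′} eq ⟨ v ⟩ = subst₂ PQ._≈ᴹ_ (sym (∧-⟨⟩ s v)) (sym (∧-⟨⟩ s′ v))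
      (mapFree-cong (_++ v) (++ˡ-resp v) eq)
    ∧-congʳ {s} {s′} eq 𝟘 = transitive (∧-zeroʳ s) (symmetric (∧-zeroʳ s′))
    ∧-congʳ {s} {s′} eq (t ⊕ r) = transitive (∧-distribˡ s t r)
      (transitive (⊕-cong (∧-congʳ eq t) (∧-congʳ eq r)) (symmetric (∧-distribˡ s′ t r)))
    ∧-congʳ {s} {s′} eq (⊖ t) = transitive (∧-⊖ s t)
      (transitive (⊖-cong (∧-congʳ eq t)) (symmetric (∧-⊖ s′ t)))
    ∧-congʳ {s} {s′} eq (a ⊙ t) = transitive (∧-⊙ s a t)
      (transitive (⊙-cong ≈-refl (∧-congʳ eq t)) (symmetric (∧-⊙ s′ a t)))

  wedge : ∀ {m ℓm : Level} {M : Module R m ℓm} {p : ℕ} → Carrierᴹ (⋀ p M) →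
          ∀ q → LinearMap (⋀ q M) (⋀ (p ℕ.+ q) M)
  wedge {M = M} {p = p} s q = record
    { ⟦_⟧ = s ∧_
    ; isModuleHomomorphism = record
      { isBimoduleHomomorphism = record
        { +ᴹ-isGroupHomomorphism = record
          { isMonoidHomomorphism = record
            { isMagmaHomomorphism = record
              { isRelHomomorphism = record { cong = ∧-congˡ M p q s }
              ; homo = ∧-distribˡ M p q s
              }
            ; ε-homo = ∧-zeroʳ M p q s
            }
          ; ⁻¹-homo = ∧-⊖ M p q s
          }
        ; *ₗ-homo = ∧-⊙ M p q s
        ; *ᵣ-homo = ∧-⊙ M p q s
        }
      }
    }

  R² : Module R c ℓ
  R² = DirectProduct.⟨module⟩ TensorUnit.⟨module⟩ TensorUnit.⟨module⟩

  e : Fin 2 → Carrierᴹ R²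
  e 0F = 1# , 0#
  e 1F = 0# , 1#

  V : ℕ → Module R c (c ⊔ ℓ)
  V d = ⨂ d R²

  -- The sign is (-1) to the number of inversions, as an element of the base ring.
  sgn : ∀ {k} → Permutation′ k → A
  sgn π = (- 1#) ^ inversions π

  -- e⊗ (π₁ ∷ … ∷ π_d ∷ []) j is the pure tensor e_{π₁(j)} ⊗ ⋯ ⊗ e_{π_d(j)}.
  e⊗ : ∀ {d} → Vec (Permutation′ 2) d → Fin 2 → Carrierᴹ (V d)
  e⊗ πs j = ⟨ Vec.map (λ π → e (π ⟨$⟩ʳ j)) πs ⟩

  ω : ∀ d → Carrierᴹ (⋀ 2 (V d))
  ω d = List.foldr _⊕_ 𝟘 (List.map
    (λ πs → sgn (∏ₚ πs) ⊙ ⟨ e⊗ πs 0F ∷ e⊗ πs 1F ∷ [] ⟩)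
    (tuples S₂ d))

  L : ∀ d n → LinearMap (⋀ n (V d)) (⋀ (2 ℕ.+ n) (V d))
  L d n = wedge {M = V d} (ω d) n

open Multilinear ℂ-commutativeRing public using (FullRank; L)

{-# OPTIONS --safe #-}

-- For odd d the summands of ω indexed by a word a and by its complement ā agree, so ω is, up to
-- a factor 2, a symplectic form on the 2^d-dimensional space V: ω = Σ_a s_a E_a ∧ E_ā with
-- s_ā = - s_a. The full rank of L is then the hard Lefschetz property of the exterior algebra.
-- With ι_a the contraction by the coordinate dual to E_a, Λ = ½ Σ_a s_a ι_ā ι_a satisfies
-- ΛL - LΛ = 2^d - 2n on ⋀ⁿV. From this, L is injective when 2n < 2^d, by descending along Λ,
-- and maps onto ⋀ⁿV when 2n > 2^d, by ascending along L until the exterior powers vanish.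
-- The argument works over any commutative ring in which 1, 2, 3, … are invertible.
module Submission where

open import Defs
open import Level using (Level; _⊔_)
open import Algebra.Bundles using (CommutativeMonoid; CommutativeRing)
open import Algebra.Module.Bundles using (Module)
import Algebra.Module.Construct.TensorUnit as TensorUnit
import Algebra.Module.Construct.Zero as Zero
open import Algebra.Module.Morphism.Structures using (module ModuleMorphisms)
import Algebra.Properties.AbelianGroup as AbelianGroupProperties
import Algebra.Properties.CommutativeSemigroup as CommutativeSemigroupProperties
import Algebra.Properties.Ring as RingProperties
import Algebra.Properties.Semiring.Mult as Mult
open import Data.Empty using (⊥-elim)
open import Data.Fin.Base as Fin using (Fin; suc; opposite)
open import Data.Fin.Patterns using (0F; 1F)
open import Data.Fin.Permutation using (Permutation′; _⟨$⟩ʳ_; transpose) renaming (id to idₚ)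
import Data.Fin.Properties as Fin
open import Data.List.Base as List using (List; []; _∷_)
open import Data.List.Membership.Propositional using (_∈_)
open import Data.List.Membership.Propositional.Properties using (∈-cartesianProductWith⁺)
import Data.List.Properties as List
open import Data.List.Relation.Unary.Any using (here; there)
open import Data.Nat.Base as ℕ using (ℕ; zero; suc; _≤_; _^_; _∸_; parity)
import Data.Nat.Properties as ℕ
open import Data.Parity.Base using (1ℙ)
open import Data.Product.Base using (∃; _×_; _,_; proj₁; proj₂)
open import Data.Rational.Base as ℚ using (ℚ; 0ℚ; 1ℚ; Positive; NonNegative)
import Data.Rational.Properties as ℚ
open import Data.Sum.Base using (_⊎_; inj₁; inj₂)
open import Data.Vec.Base as Vec using (Vec; []; _∷_; _[_]≔_; lookup)
import Data.Vec.Properties as Vec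
open import Data.Vec.Relation.Binary.Pointwise.Inductive as Pointwise using (Pointwise; []; _∷_)
open import Function.Base using (_∘_)
open import Relation.Binary.Core using (Rel)
open import Relation.Binary.PropositionalEquality.Core as ≡ using (_≡_)
import Relation.Binary.Reasoning.Setoid as SetoidReasoning
open import Relation.Nullary.Decidable using (yes; no)

-- Linear maps and sums over binary words

-- The exterior powers are formal combinations modulo generated relations, and equality in ℂ is not
-- decidable, so the proof avoids bases, dimension counts and duality between complementary degrees.
-- Injectivity and surjectivity are each read off from the commutator, by inductions running in
-- opposite directions through the degrees. Both carry a scalar c, to which every use of the
-- commutator adds a positive integer; invertibility of positive integers then does the work of a
-- rank argument. The vanishing of ⋀ⁿV for n > 2^d is also obtained from operators: Σ_a E_a ∧ ι_a
-- multiplies ⋀ⁿV by n, so in positive degree an element killed by every ι_a is zero. The parity of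
-- d enters through s_ā = (-1)^d s_a; for even d the summands of a and ā would cancel. The ½ in Λ is
-- there because a sum over all words meets each pair {a, ā} twice.

module LinearMaps {c ℓ : Level} (R : CommutativeRing c ℓ) where

  open CommutativeRing R renaming (Carrier to A)
  open Multilinear R using (LinearMap)
  open Mult semiring using () renaming (_×_ to _×ᴿ_)
  open LinearMap using (⟦_⟧)

  private variable
    m ℓm n ℓn p ℓp : Level
    M : Module R m ℓm
    N : Module R n ℓn
    P : Module R p ℓp

  module Mod {m ℓm : Level} (M : Module R m ℓm) where
    open Module M public
    open AbelianGroupProperties +ᴹ-abelianGroup public using ()
      renaming ( inverseˡ-unique to -ᴹ-uniqueˡ; ⁻¹-involutive to -ᴹ-involutive
               ; ⁻¹-∙-comm to -ᴹ-+ᴹ-comm; ε⁻¹≈ε to -ᴹ0≈0; ∙-cancelʳ to +ᴹ-cancelʳ)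
    open CommutativeSemigroupProperties
      (CommutativeMonoid.commutativeSemigroup +ᴹ-commutativeMonoid) public using ()
      renaming (interchange to +ᴹ-interchange)
    open SetoidReasoning ≈ᴹ-setoid public

    -ᴹ‿*ₗ : ∀ a x → (- a) *ₗ x ≈ᴹ -ᴹ (a *ₗ x)
    -ᴹ‿*ₗ a x = -ᴹ-uniqueˡ ((- a) *ₗ x) (a *ₗ x) (begin
      (- a) *ₗ x +ᴹ a *ₗ x ≈⟨ *ₗ-distribʳ x (- a) a ⟨
      (- a + a) *ₗ x       ≈⟨ *ₗ-congʳ (-‿inverseˡ a) ⟩
      0# *ₗ x              ≈⟨ *ₗ-zeroˡ x ⟩
      0ᴹ                   ∎)

    *ₗ‿-ᴹ : ∀ a x → a *ₗ (-ᴹ x) ≈ᴹ -ᴹ (a *ₗ x)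
    *ₗ‿-ᴹ a x = -ᴹ-uniqueˡ (a *ₗ (-ᴹ x)) (a *ₗ x) (begin
      a *ₗ (-ᴹ x) +ᴹ a *ₗ x ≈⟨ *ₗ-distribˡ a (-ᴹ x) x ⟨
      a *ₗ (-ᴹ x +ᴹ x)      ≈⟨ *ₗ-congˡ (-ᴹ‿inverseˡ x) ⟩
      a *ₗ 0ᴹ               ≈⟨ *ₗ-zeroʳ a ⟩
      0ᴹ                    ∎)

  module Lin {m ℓm n ℓn : Level} {M : Module R m ℓm} {N : Module R n ℓn}
             (F : LinearMap M N) where
    private
      module M = Module M
      module N = Module N
      module F = ModuleMorphisms.IsModuleHomomorphism (LinearMap.isModuleHomomorphism F)

    ⟦⟧-cong : ∀ {x y} → x M.≈ᴹ y → ⟦ F ⟧ x N.≈ᴹ ⟦ F ⟧ y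
    ⟦⟧-cong = F.⟦⟧-cong

    +ᴹ-homo : ∀ x y → ⟦ F ⟧ (x M.+ᴹ y) N.≈ᴹ ⟦ F ⟧ x N.+ᴹ ⟦ F ⟧ y
    +ᴹ-homo = F.+ᴹ-homo

    *ₗ-homo : ∀ a x → ⟦ F ⟧ (a M.*ₗ x) N.≈ᴹ a N.*ₗ ⟦ F ⟧ x
    *ₗ-homo = F.*ₗ-homo

    -ᴹ-homo : ∀ x → ⟦ F ⟧ (M.-ᴹ x) N.≈ᴹ N.-ᴹ ⟦ F ⟧ x
    -ᴹ-homo = F.-ᴹ-homo

    0ᴹ-homo : ⟦ F ⟧ M.0ᴹ N.≈ᴹ N.0ᴹ
    0ᴹ-homo = F.0ᴹ-homo

  module _ {m ℓm n ℓn : Level} (M : Module R m ℓm) (N : Module R n ℓn) where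

    private
      module M = Mod M
      module N = Mod N

    linear : (f : M.Carrierᴹ → N.Carrierᴹ) →
      (∀ {x y} → x M.≈ᴹ y → f x N.≈ᴹ f y) →
      (∀ x y → f (x M.+ᴹ y) N.≈ᴹ f x N.+ᴹ f y) →
      (∀ a x → f (a M.*ₗ x) N.≈ᴹ a N.*ₗ f x) → LinearMap M N
    linear f f-cong f-+ f-* = record
      { ⟦_⟧ = f
      ; isModuleHomomorphism = record
        { isBimoduleHomomorphism = record
          { +ᴹ-isGroupHomomorphism = record
            { isMonoidHomomorphism = record
              { isMagmaHomomorphism = record
                { isRelHomomorphism = record { cong = f-cong }
                ; homo = f-+
                }
              ; ε-homo = f-0
              }
            ; ⁻¹-homo = λ x → N.-ᴹ-uniqueˡ (f (M.-ᴹ x)) (f x)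
                (N.≈ᴹ-trans (N.≈ᴹ-sym (f-+ (M.-ᴹ x) x))
                  (N.≈ᴹ-trans (f-cong (M.-ᴹ‿inverseˡ x)) f-0))
            }
          ; *ₗ-homo = f-*
          ; *ᵣ-homo = λ a x → N.≈ᴹ-trans (f-cong (M.≈ᴹ-sym (M.*ₗ-*ᵣ-coincident a x)))
              (N.≈ᴹ-trans (f-* a x) (N.*ₗ-*ᵣ-coincident a (f x)))
          }
        }
      }
      where
      f-0 : f M.0ᴹ N.≈ᴹ N.0ᴹ
      f-0 = N.≈ᴹ-trans (f-cong (M.≈ᴹ-sym (M.*ₗ-zeroˡ M.0ᴹ)))
        (N.≈ᴹ-trans (f-* 0# M.0ᴹ) (N.*ₗ-zeroˡ (f M.0ᴹ)))

  zeroₗ : LinearMap M N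
  zeroₗ {M = M} {N = N} = linear M N (λ _ → 0ᴹ) (λ _ → ≈ᴹ-refl)
    (λ _ _ → ≈ᴹ-sym (+ᴹ-identityˡ 0ᴹ)) (λ a _ → ≈ᴹ-sym (*ₗ-zeroʳ a))
    where open Module N

  idₗ : LinearMap M M
  idₗ {M = M} = linear M M (λ x → x) (λ p → p) (λ _ _ → ≈ᴹ-refl) (λ _ _ → ≈ᴹ-refl)
    where open Module M

  infixr 9 _∘ₗ_
  infixl 6 _+ₗ_
  infixr 7 _·ₗ_

  _∘ₗ_ : LinearMap N P → LinearMap M N → LinearMap M P
  _∘ₗ_ {P = P} {M = M} G F = linear M P (⟦ G ⟧ ∘ ⟦ F ⟧) (G.⟦⟧-cong ∘ F.⟦⟧-cong)
    (λ x y → ≈ᴹ-trans (G.⟦⟧-cong (F.+ᴹ-homo x y)) (G.+ᴹ-homo (⟦ F ⟧ x) (⟦ F ⟧ y)))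
    (λ a x → ≈ᴹ-trans (G.⟦⟧-cong (F.*ₗ-homo a x)) (G.*ₗ-homo a (⟦ F ⟧ x)))
    where
    open Module P
    module F = Lin F
    module G = Lin G

  _+ₗ_ : LinearMap M N → LinearMap M N → LinearMap M N
  _+ₗ_ {M = M} {N = N} F G = linear M N (λ x → ⟦ F ⟧ x +ᴹ ⟦ G ⟧ x)
    (λ p → +ᴹ-cong (F.⟦⟧-cong p) (G.⟦⟧-cong p))
    (λ x y → ≈ᴹ-trans (+ᴹ-cong (F.+ᴹ-homo x y) (G.+ᴹ-homo x y))
      (+ᴹ-interchange (⟦ F ⟧ x) (⟦ F ⟧ y) (⟦ G ⟧ x) (⟦ G ⟧ y)))
    (λ a x → ≈ᴹ-trans (+ᴹ-cong (F.*ₗ-homo a x) (G.*ₗ-homo a x))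
      (≈ᴹ-sym (*ₗ-distribˡ a (⟦ F ⟧ x) (⟦ G ⟧ x))))
    where
    open Mod N
    module F = Lin F
    module G = Lin G

  _·ₗ_ : A → LinearMap M N → LinearMap M N
  _·ₗ_ {M = M} {N = N} a F = linear M N (λ x → a *ₗ ⟦ F ⟧ x) (*ₗ-congˡ ∘ F.⟦⟧-cong)
    (λ x y → ≈ᴹ-trans (*ₗ-congˡ (F.+ᴹ-homo x y)) (*ₗ-distribˡ a (⟦ F ⟧ x) (⟦ F ⟧ y)))
    (λ b x → ≈ᴹ-trans (*ₗ-congˡ (F.*ₗ-homo b x)) (≈ᴹ-trans (≈ᴹ-sym (*ₗ-assoc a b (⟦ F ⟧ x)))
      (≈ᴹ-trans (*ₗ-congʳ (*-comm a b)) (*ₗ-assoc b a (⟦ F ⟧ x)))))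
    where
    open Mod N
    module F = Lin F

  -ₗ_ : LinearMap M N → LinearMap M N
  -ₗ_ {M = M} {N = N} F = linear M N (λ x → -ᴹ ⟦ F ⟧ x) (-ᴹ‿cong ∘ F.⟦⟧-cong)
    (λ x y → ≈ᴹ-trans (-ᴹ‿cong (F.+ᴹ-homo x y)) (≈ᴹ-sym (-ᴹ-+ᴹ-comm (⟦ F ⟧ x) (⟦ F ⟧ y))))
    (λ b x → ≈ᴹ-trans (-ᴹ‿cong (F.*ₗ-homo b x)) (≈ᴹ-sym (*ₗ‿-ᴹ b (⟦ F ⟧ x))))
    where
    open Mod N
    module F = Lin F

  scalars : Module R c ℓ
  scalars = TensorUnit.⟨module⟩

  -- The rank one map φ ⊗ y.
  _▹_ : LinearMap M scalars → Module.Carrierᴹ N → LinearMap M N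
  _▹_ {M = M} {N = N} φ y = linear M N (λ v → ⟦ φ ⟧ v *ₗ y) (*ₗ-congʳ ∘ φ.⟦⟧-cong)
    (λ u v → ≈ᴹ-trans (*ₗ-congʳ (φ.+ᴹ-homo u v)) (*ₗ-distribʳ y _ _))
    (λ a u → ≈ᴹ-trans (*ₗ-congʳ (φ.*ₗ-homo a u)) (*ₗ-assoc a _ y))
    where
    open Module N
    module φ = Lin φ

  Word : ℕ → Set
  Word d = Vec (Fin 2) d

  conj : ∀ {d} → Word d → Word d
  conj = Vec.map opposite

  conj-involutive : ∀ {d} (a : Word d) → conj (conj a) ≡ a
  conj-involutive []       = ≡.refl
  conj-involutive (0F ∷ a) = ≡.cong (0F ∷_) (conj-involutive a)
  conj-involutive (1F ∷ a) = ≡.cong (1F ∷_) (conj-involutive a)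

  nat : ℕ → A
  nat k = k ×ᴿ 1#

  NatInvertible : Set (c ⊔ ℓ)
  NatInvertible = ∀ k → ∃ λ r → r * nat (suc k) ≈ 1#

  module Sum {m ℓm : Level} (M : Module R m ℓm) where

    open Mod M

    -- Branching on the first letter turns complementation of words into a swap of the two halves at
    -- every level, so `∑-conj` requires no permutation of a list.
    ∑ : ∀ {d} → (Word d → Carrierᴹ) → Carrierᴹ
    ∑ {zero}  f = f []
    ∑ {suc d} f = ∑ (f ∘ (0F ∷_)) +ᴹ ∑ (f ∘ (1F ∷_))

    ∑-cong : ∀ {d} {f g : Word d → Carrierᴹ} → (∀ a → f a ≈ᴹ g a) → ∑ f ≈ᴹ ∑ g
    ∑-cong {zero}  f≈g = f≈g []
    ∑-cong {suc d} f≈g = +ᴹ-cong (∑-cong (f≈g ∘ (0F ∷_))) (∑-cong (f≈g ∘ (1F ∷_)))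

    ∑-+ : ∀ {d} (f g : Word d → Carrierᴹ) → ∑ (λ a → f a +ᴹ g a) ≈ᴹ ∑ f +ᴹ ∑ g
    ∑-+ {zero}  f g = ≈ᴹ-refl
    ∑-+ {suc d} f g = ≈ᴹ-trans
      (+ᴹ-cong (∑-+ (f ∘ (0F ∷_)) (g ∘ (0F ∷_))) (∑-+ (f ∘ (1F ∷_)) (g ∘ (1F ∷_))))
      (+ᴹ-interchange _ _ _ _)

    ∑-* : ∀ {d} r (f : Word d → Carrierᴹ) → ∑ (λ a → r *ₗ f a) ≈ᴹ r *ₗ ∑ f
    ∑-* {zero}  r f = ≈ᴹ-refl
    ∑-* {suc d} r f = ≈ᴹ-trans (+ᴹ-cong (∑-* r (f ∘ (0F ∷_))) (∑-* r (f ∘ (1F ∷_))))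
      (≈ᴹ-sym (*ₗ-distribˡ r _ _))

    ∑-0 : ∀ {d} {f : Word d → Carrierᴹ} → (∀ a → f a ≈ᴹ 0ᴹ) → ∑ f ≈ᴹ 0ᴹ
    ∑-0 {zero}  f≈0 = f≈0 []
    ∑-0 {suc d} f≈0 = ≈ᴹ-trans (+ᴹ-cong (∑-0 (f≈0 ∘ (0F ∷_))) (∑-0 (f≈0 ∘ (1F ∷_))))
      (+ᴹ-identityˡ 0ᴹ)

    ∑-conj : ∀ {d} (f : Word d → Carrierᴹ) → ∑ (f ∘ conj) ≈ᴹ ∑ f
    ∑-conj {zero}  f = ≈ᴹ-refl
    ∑-conj {suc d} f = ≈ᴹ-trans (+ᴹ-cong (∑-conj (f ∘ (1F ∷_))) (∑-conj (f ∘ (0F ∷_))))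
      (+ᴹ-comm _ _)

    ∑-const : ∀ d x → ∑ {d} (λ _ → x) ≈ᴹ nat (2 ℕ.^ d) *ₗ x
    ∑-const zero x = ≈ᴹ-sym (≈ᴹ-trans (*ₗ-congʳ (+-identityʳ 1#)) (*ₗ-identityˡ x))
    ∑-const (suc d) x = begin
      ∑ {d} (λ _ → x) +ᴹ ∑ {d} (λ _ → x)     ≈⟨ +ᴹ-cong (∑-const d x) (∑-const d x) ⟩
      nat k *ₗ x +ᴹ nat k *ₗ x               ≈⟨ *ₗ-distribʳ x (nat k) (nat k) ⟨
      (nat k + nat k) *ₗ x                   ≈⟨ *ₗ-congʳ (Mult.×-homo-+ semiring 1# k k) ⟨
      nat (k ℕ.+ k) *ₗ x                     ≡⟨ ≡.cong (λ j → nat (k ℕ.+ j) *ₗ x) (ℕ.+-identityʳ k) ⟨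
      nat (2 ℕ.^ suc d) *ₗ x                 ∎
      where k = 2 ℕ.^ d

  module _ {m ℓm n ℓn : Level} {M : Module R m ℓm} {N : Module R n ℓn} where

    private
      module M = Module M
      module N = Mod N
      module ∑M = Sum M
      module ∑N = Sum N

    ∑-homo : ∀ (F : LinearMap M N) {d} (f : Word d → M.Carrierᴹ) →
             ⟦ F ⟧ (∑M.∑ f) N.≈ᴹ ∑N.∑ (⟦ F ⟧ ∘ f)
    ∑-homo F {zero}  f = N.≈ᴹ-refl
    ∑-homo F {suc d} f = N.≈ᴹ-trans (Lin.+ᴹ-homo F _ _)
      (N.+ᴹ-cong (∑-homo F (f ∘ (0F ∷_))) (∑-homo F (f ∘ (1F ∷_))))

    ∑ₗ : ∀ {d} → (Word d → LinearMap M N) → LinearMap M N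
    ∑ₗ F = linear M N (λ x → ∑N.∑ λ a → ⟦ F a ⟧ x)
      (λ p → ∑N.∑-cong λ a → Lin.⟦⟧-cong (F a) p)
      (λ x y → N.≈ᴹ-trans (∑N.∑-cong λ a → Lin.+ᴹ-homo (F a) x y) (∑N.∑-+ (λ a → ⟦ F a ⟧ x) (λ a → ⟦ F a ⟧ y)))
      (λ r x → N.≈ᴹ-trans (∑N.∑-cong λ a → Lin.*ₗ-homo (F a) r x) (∑N.∑-* r (λ a → ⟦ F a ⟧ x)))

-- Hard Lefschetz from the canonical anticommutation relations

module Lefschetz {c ℓ : Level} (R : CommutativeRing c ℓ)
  (nat-inverse : LinearMaps.NatInvertible R)
  {m ℓm : Level} (B : ℕ → Module R m ℓm) where

  open CommutativeRing R renaming (Carrier to A)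
  open LinearMaps R
  open Multilinear R using (LinearMap)
  open LinearMap using (⟦_⟧)

  private
    module _ {n : ℕ} where
      open Mod (B n) public hiding (Carrierᴹ)
    ∣_∣ : ℕ → Set m
    ∣ n ∣ = Module.Carrierᴹ (B n)

  nat-torsion-free : ∀ k {n} {x : ∣ n ∣} → nat (suc k) *ₗ x ≈ᴹ 0ᴹ → x ≈ᴹ 0ᴹ
  nat-torsion-free k {n} {x} kx≈0 with r , rk≈1 ← nat-inverse k = begin
    x                       ≈⟨ *ₗ-identityˡ x ⟨
    1# *ₗ x                 ≈⟨ *ₗ-congʳ rk≈1 ⟨
    (r * nat (suc k)) *ₗ x  ≈⟨ *ₗ-assoc r (nat (suc k)) x ⟩
    r *ₗ nat (suc k) *ₗ x   ≈⟨ *ₗ-congˡ kx≈0 ⟩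
    r *ₗ 0ᴹ                 ≈⟨ *ₗ-zeroʳ r ⟩
    0ᴹ                      ∎

  nat-+-*ₗ : ∀ j k {n} (x : ∣ n ∣) → nat (j ℕ.+ k) *ₗ x ≈ᴹ nat j *ₗ x +ᴹ nat k *ₗ x
  nat-+-*ₗ j k x = ≈ᴹ-trans (*ₗ-congʳ (Mult.×-homo-+ semiring 1# j k))
    (*ₗ-distribʳ x (nat j) (nat k))

  -- Injectivity and surjectivity from the commutator of L and Λ

  module SL₂
    (B₀-trivial : (x : ∣ 0 ∣) → x ≈ᴹ 0ᴹ) (B₁-trivial : (x : ∣ 1 ∣) → x ≈ᴹ 0ᴹ)
    (L : ∀ n → LinearMap (B n) (B (2 ℕ.+ n))) (Λ : ∀ n → LinearMap (B (2 ℕ.+ n)) (B n))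
    (N : ℕ) (N-bound : ∀ n → N ℕ.< n → (x : ∣ 2 ℕ.+ n ∣) → x ≈ᴹ 0ᴹ)
    (commutator : ∀ n (x : ∣ 2 ℕ.+ n ∣) →
      ⟦ Λ (2 ℕ.+ n) ⟧ (⟦ L (2 ℕ.+ n) ⟧ x) +ᴹ nat (n ℕ.+ n) *ₗ x ≈ᴹ
      ⟦ L n ⟧ (⟦ Λ n ⟧ x) +ᴹ nat N *ₗ x)
    where

    -- The weight N - 2n is a natural number only up to the middle degree. The commutator is
    -- therefore used in two subtraction-free forms, one on each side of the middle, with h the
    -- absolute value of the weight.
    commutator-below : ∀ n {h} → n ℕ.+ n ℕ.+ h ≡ N → (x : ∣ 2 ℕ.+ n ∣) →
      ⟦ Λ (2 ℕ.+ n) ⟧ (⟦ L (2 ℕ.+ n) ⟧ x) ≈ᴹ ⟦ L n ⟧ (⟦ Λ n ⟧ x) +ᴹ nat h *ₗ x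
    commutator-below n {h} 2n+h≡N x = +ᴹ-cancelʳ (nat (n ℕ.+ n) *ₗ x) _ _ (begin
      ΛLx +ᴹ nat (n ℕ.+ n) *ₗ x                       ≈⟨ commutator n x ⟩
      LΛx +ᴹ nat N *ₗ x                               ≡⟨ ≡.cong (λ k → LΛx +ᴹ nat k *ₗ x) 2n+h≡N ⟨
      LΛx +ᴹ nat (n ℕ.+ n ℕ.+ h) *ₗ x                 ≈⟨ +ᴹ-congˡ (nat-+-*ₗ (n ℕ.+ n) h x) ⟩
      LΛx +ᴹ (nat (n ℕ.+ n) *ₗ x +ᴹ nat h *ₗ x)       ≈⟨ +ᴹ-congˡ (+ᴹ-comm _ _) ⟩
      LΛx +ᴹ (nat h *ₗ x +ᴹ nat (n ℕ.+ n) *ₗ x)       ≈⟨ +ᴹ-assoc _ _ _ ⟨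
      LΛx +ᴹ nat h *ₗ x +ᴹ nat (n ℕ.+ n) *ₗ x         ∎)
      where
      ΛLx = ⟦ Λ (2 ℕ.+ n) ⟧ (⟦ L (2 ℕ.+ n) ⟧ x)
      LΛx = ⟦ L n ⟧ (⟦ Λ n ⟧ x)

    commutator-above : ∀ n {h} → N ℕ.+ h ≡ n ℕ.+ n → (x : ∣ 2 ℕ.+ n ∣) →
      ⟦ L n ⟧ (⟦ Λ n ⟧ x) ≈ᴹ ⟦ Λ (2 ℕ.+ n) ⟧ (⟦ L (2 ℕ.+ n) ⟧ x) +ᴹ nat h *ₗ x
    commutator-above n {h} N+h≡2n x = +ᴹ-cancelʳ (nat N *ₗ x) _ _ (begin
      LΛx +ᴹ nat N *ₗ x                       ≈⟨ commutator n x ⟨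
      ΛLx +ᴹ nat (n ℕ.+ n) *ₗ x               ≡⟨ ≡.cong (λ k → ΛLx +ᴹ nat k *ₗ x) N+h≡2n ⟨
      ΛLx +ᴹ nat (N ℕ.+ h) *ₗ x               ≈⟨ +ᴹ-congˡ (nat-+-*ₗ N h x) ⟩
      ΛLx +ᴹ (nat N *ₗ x +ᴹ nat h *ₗ x)       ≈⟨ +ᴹ-congˡ (+ᴹ-comm _ _) ⟩
      ΛLx +ᴹ (nat h *ₗ x +ᴹ nat N *ₗ x)       ≈⟨ +ᴹ-assoc _ _ _ ⟨
      ΛLx +ᴹ nat h *ₗ x +ᴹ nat N *ₗ x         ∎)
      where
      ΛLx = ⟦ Λ (2 ℕ.+ n) ⟧ (⟦ L (2 ℕ.+ n) ⟧ x)
      LΛx = ⟦ L n ⟧ (⟦ Λ n ⟧ x)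

    -- In degree n the operator ΛL + c turns into LΛ + (c + h) with h > 0, so Λ carries
    -- its kernel into the kernel of ΛL + (c + h) two degrees below.
    ΛL+c-kernel : ∀ n c → n ℕ.+ n ℕ.< 4 ℕ.+ N → (x : ∣ n ∣) →
      ⟦ Λ n ⟧ (⟦ L n ⟧ x) +ᴹ nat c *ₗ x ≈ᴹ 0ᴹ → x ≈ᴹ 0ᴹ
    ΛL+c-kernel 0 c n< x eq = B₀-trivial x
    ΛL+c-kernel 1 c n< x eq = B₁-trivial x
    ΛL+c-kernel (suc (suc n)) c n< x eq = nat-torsion-free (h ℕ.+ c) (begin
      nat (suc h ℕ.+ c) *ₗ x                              ≈⟨ +ᴹ-identityˡ _ ⟨
      0ᴹ +ᴹ nat (suc h ℕ.+ c) *ₗ x                        ≈⟨ +ᴹ-congʳ (Lin.0ᴹ-homo (L n)) ⟨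
      ⟦ L n ⟧ 0ᴹ +ᴹ nat (suc h ℕ.+ c) *ₗ x                ≈⟨ +ᴹ-congʳ (Lin.⟦⟧-cong (L n) Λx≈0) ⟨
      ⟦ L n ⟧ (⟦ Λ n ⟧ x) +ᴹ nat (suc h ℕ.+ c) *ₗ x       ≈⟨ LΛ-eq ⟩
      0ᴹ                                                  ∎)
      where
      -- The index of `B` exceeds the exterior degree by two, so the 4 in the bound makes it say
      -- that twice the exterior degree is below N.
      2n<N : n ℕ.+ n ℕ.< N
      2n<N = ℕ.+-cancelˡ-< 4 (n ℕ.+ n) N (≡.subst (ℕ._< 4 ℕ.+ N)
        (≡.cong (2 ℕ.+_) (≡.trans (ℕ.+-suc n (suc n)) (≡.cong suc (ℕ.+-suc n n)))) n<)
      h : ℕ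
      h = N ℕ.∸ suc (n ℕ.+ n)
      N-split : n ℕ.+ n ℕ.+ suc h ≡ N
      N-split = ≡.trans (ℕ.+-suc (n ℕ.+ n) h) (ℕ.m+[n∸m]≡n 2n<N)
      LΛ-eq : ⟦ L n ⟧ (⟦ Λ n ⟧ x) +ᴹ nat (suc h ℕ.+ c) *ₗ x ≈ᴹ 0ᴹ
      LΛ-eq = begin
        ⟦ L n ⟧ (⟦ Λ n ⟧ x) +ᴹ nat (suc h ℕ.+ c) *ₗ x                ≈⟨ +ᴹ-congˡ (nat-+-*ₗ (suc h) c x) ⟩
        ⟦ L n ⟧ (⟦ Λ n ⟧ x) +ᴹ (nat (suc h) *ₗ x +ᴹ nat c *ₗ x)      ≈⟨ +ᴹ-assoc _ _ _ ⟨
        ⟦ L n ⟧ (⟦ Λ n ⟧ x) +ᴹ nat (suc h) *ₗ x +ᴹ nat c *ₗ x        ≈⟨ +ᴹ-congʳ (commutator-below n N-split x) ⟨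
        ⟦ Λ (2 ℕ.+ n) ⟧ (⟦ L (2 ℕ.+ n) ⟧ x) +ᴹ nat c *ₗ x            ≈⟨ eq ⟩
        0ᴹ                                                           ∎
      Λx≈0 : ⟦ Λ n ⟧ x ≈ᴹ 0ᴹ
      Λx≈0 = ΛL+c-kernel n (suc h ℕ.+ c) (ℕ.<-≤-trans 2n<N (ℕ.m≤n+m N 4)) (⟦ Λ n ⟧ x) (begin
        ⟦ Λ n ⟧ (⟦ L n ⟧ (⟦ Λ n ⟧ x)) +ᴹ nat (suc h ℕ.+ c) *ₗ ⟦ Λ n ⟧ x
          ≈⟨ +ᴹ-congˡ (Lin.*ₗ-homo (Λ n) _ x) ⟨
        ⟦ Λ n ⟧ (⟦ L n ⟧ (⟦ Λ n ⟧ x)) +ᴹ ⟦ Λ n ⟧ (nat (suc h ℕ.+ c) *ₗ x)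
          ≈⟨ Lin.+ᴹ-homo (Λ n) _ _ ⟨
        ⟦ Λ n ⟧ (⟦ L n ⟧ (⟦ Λ n ⟧ x) +ᴹ nat (suc h ℕ.+ c) *ₗ x)
          ≈⟨ Lin.⟦⟧-cong (Λ n) LΛ-eq ⟩
        ⟦ Λ n ⟧ 0ᴹ
          ≈⟨ Lin.0ᴹ-homo (Λ n) ⟩
        0ᴹ ∎)

    L-kernel : ∀ n → n ℕ.+ n ℕ.< N → (x : ∣ 2 ℕ.+ n ∣) → ⟦ L (2 ℕ.+ n) ⟧ x ≈ᴹ 0ᴹ → x ≈ᴹ 0ᴹ
    L-kernel n 2n<N x Lx≈0 = ΛL+c-kernel (2 ℕ.+ n) 0
      (≡.subst (ℕ._< 4 ℕ.+ N)
        (≡.cong (2 ℕ.+_) (≡.sym (≡.trans (ℕ.+-suc n (suc n)) (≡.cong suc (ℕ.+-suc n n)))))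
        (ℕ.+-monoʳ-< 4 2n<N))
      x (begin
        ⟦ Λ _ ⟧ (⟦ L _ ⟧ x) +ᴹ nat 0 *ₗ x    ≈⟨ +ᴹ-cong (Lin.⟦⟧-cong (Λ _) Lx≈0) (*ₗ-zeroˡ x) ⟩
        ⟦ Λ (2 ℕ.+ n) ⟧ 0ᴹ +ᴹ 0ᴹ             ≈⟨ +ᴹ-identityʳ _ ⟩
        ⟦ Λ (2 ℕ.+ n) ⟧ 0ᴹ                   ≈⟨ Lin.0ᴹ-homo (Λ _) ⟩
        0ᴹ                                   ∎)

    -- Dually, in degree n the operator LΛ + c equals ΛL + (c + h) with h > 0; if z solves
    -- (LΛ + (c + h)) z = L y two degrees above, then x = (y - Λz) / (c + h) works.
    LΛ+c-surjective : ∀ k n c → N ℕ.< k ℕ.+ n → N ℕ.< n ℕ.+ n → (y : ∣ 2 ℕ.+ n ∣) →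
      ∃ λ x → ⟦ L n ⟧ (⟦ Λ n ⟧ x) +ᴹ nat c *ₗ x ≈ᴹ y
    -- `k` is fuel: each recursive call moves two degrees up. Once it is spent, n exceeds N and the
    -- module is trivial, so any element is a solution.
    LΛ+c-surjective zero n c N<n N<2n y = y , ≈ᴹ-trans (N-bound n N<n _) (≈ᴹ-sym (N-bound n N<n y))
    LΛ+c-surjective (suc k) n c N<k+n N<2n y = r *ₗ w , (begin
      ⟦ L n ⟧ (⟦ Λ n ⟧ (r *ₗ w)) +ᴹ nat c *ₗ r *ₗ w
        ≈⟨ +ᴹ-congʳ (commutator-above n N-split (r *ₗ w)) ⟩
      Λ₂ (L₂ (r *ₗ w)) +ᴹ nat (suc h) *ₗ r *ₗ w +ᴹ nat c *ₗ r *ₗ w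
        ≈⟨ +ᴹ-assoc _ _ _ ⟩
      Λ₂ (L₂ (r *ₗ w)) +ᴹ (nat (suc h) *ₗ r *ₗ w +ᴹ nat c *ₗ r *ₗ w)
        ≈⟨ +ᴹ-congˡ (nat-+-*ₗ (suc h) c (r *ₗ w)) ⟨
      Λ₂ (L₂ (r *ₗ w)) +ᴹ nat (suc h ℕ.+ c) *ₗ r *ₗ w
        ≈⟨ +ᴹ-congˡ (≈ᴹ-trans (≈ᴹ-sym (*ₗ-assoc _ r w)) (≈ᴹ-trans (*ₗ-congʳ (*-comm _ r)) (*ₗ-assoc r _ w))) ⟩
      Λ₂ (L₂ (r *ₗ w)) +ᴹ r *ₗ nat (suc h ℕ.+ c) *ₗ w
        ≈⟨ +ᴹ-congʳ (≈ᴹ-trans (Lin.⟦⟧-cong (Λ _) (Lin.*ₗ-homo (L _) r w)) (Lin.*ₗ-homo (Λ _) r _)) ⟩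
      r *ₗ Λ₂ (L₂ w) +ᴹ r *ₗ nat (suc h ℕ.+ c) *ₗ w
        ≈⟨ *ₗ-distribˡ r _ _ ⟨
      r *ₗ (Λ₂ (L₂ w) +ᴹ nat (suc h ℕ.+ c) *ₗ w)
        ≈⟨ *ₗ-congˡ unscaled ⟩
      r *ₗ nat (suc h ℕ.+ c) *ₗ y
        ≈⟨ *ₗ-assoc r _ y ⟨
      (r * nat (suc h ℕ.+ c)) *ₗ y
        ≈⟨ *ₗ-congʳ (proj₂ (nat-inverse (h ℕ.+ c))) ⟩
      1# *ₗ y
        ≈⟨ *ₗ-identityˡ y ⟩
      y ∎)
      where
      h : ℕ
      h = n ℕ.+ n ℕ.∸ suc N
      N-split : N ℕ.+ suc h ≡ n ℕ.+ n
      N-split = ≡.trans (ℕ.+-suc N h) (ℕ.m+[n∸m]≡n N<2n)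
      r : A
      r = proj₁ (nat-inverse (h ℕ.+ c))
      Λ₂ = ⟦ Λ (2 ℕ.+ n) ⟧
      L₂ = ⟦ L (2 ℕ.+ n) ⟧
      N<k+2+n : N ℕ.< k ℕ.+ (2 ℕ.+ n)
      N<k+2+n = ℕ.<-≤-trans N<k+n (ℕ.≤-trans (ℕ.n≤1+n _) (ℕ.≤-reflexive
        (≡.sym (≡.trans (ℕ.+-suc k (suc n)) (≡.cong suc (ℕ.+-suc k n))))))
      above : ∃ λ z → ⟦ L (2 ℕ.+ n) ⟧ (⟦ Λ (2 ℕ.+ n) ⟧ z) +ᴹ nat (suc h ℕ.+ c) *ₗ z ≈ᴹ L₂ y
      above = LΛ+c-surjective k (2 ℕ.+ n) (suc h ℕ.+ c) N<k+2+n
        (ℕ.<-≤-trans N<2n (ℕ.+-mono-≤ (ℕ.m≤n+m n 2) (ℕ.m≤n+m n 2))) (L₂ y)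
      z = proj₁ above
      w : ∣ 2 ℕ.+ n ∣
      w = y +ᴹ -ᴹ Λ₂ z
      q : A
      q = nat (suc h ℕ.+ c)
      -- After L y is replaced by LΛz + qz, the two copies of LΛz cancel, and the remaining Λ(qz)
      -- cancels the -qΛz that comes from q times w.
      unscaled : Λ₂ (L₂ w) +ᴹ q *ₗ w ≈ᴹ q *ₗ y
      unscaled = begin
        Λ₂ (L₂ w) +ᴹ q *ₗ w
          ≈⟨ +ᴹ-cong (Lin.⟦⟧-cong (Λ _) (Lin.+ᴹ-homo (L _) y _)) (*ₗ-distribˡ q y _) ⟩
        Λ₂ (L₂ y +ᴹ L₂ (-ᴹ Λ₂ z)) +ᴹ (q *ₗ y +ᴹ q *ₗ (-ᴹ Λ₂ z))
          ≈⟨ +ᴹ-cong (Lin.⟦⟧-cong (Λ _) (+ᴹ-cong (≈ᴹ-sym (proj₂ above)) (Lin.-ᴹ-homo (L _) _)))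
                     (+ᴹ-congˡ (*ₗ‿-ᴹ q _)) ⟩
        Λ₂ (L₂ (Λ₂ z) +ᴹ q *ₗ z +ᴹ -ᴹ L₂ (Λ₂ z)) +ᴹ (q *ₗ y +ᴹ -ᴹ (q *ₗ Λ₂ z))
          ≈⟨ +ᴹ-congʳ (Lin.⟦⟧-cong (Λ _) (≈ᴹ-trans (+ᴹ-congʳ (+ᴹ-comm _ _))
               (≈ᴹ-trans (+ᴹ-assoc _ _ _) (≈ᴹ-trans (+ᴹ-congˡ (-ᴹ‿inverseʳ _)) (+ᴹ-identityʳ _))))) ⟩
        Λ₂ (q *ₗ z) +ᴹ (q *ₗ y +ᴹ -ᴹ (q *ₗ Λ₂ z))
          ≈⟨ +ᴹ-cong (Lin.*ₗ-homo (Λ _) q z) (+ᴹ-comm _ _) ⟩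
        q *ₗ Λ₂ z +ᴹ (-ᴹ (q *ₗ Λ₂ z) +ᴹ q *ₗ y)
          ≈⟨ +ᴹ-assoc _ _ _ ⟨
        q *ₗ Λ₂ z +ᴹ -ᴹ (q *ₗ Λ₂ z) +ᴹ q *ₗ y
          ≈⟨ ≈ᴹ-trans (+ᴹ-congʳ (-ᴹ‿inverseʳ _)) (+ᴹ-identityˡ _) ⟩
        q *ₗ y ∎

    -- For c = 0 a solution of LΛx = y exhibits Λx as a preimage. Fuel N + 1 is enough from any
    -- degree.
    L-preimage : ∀ n → N ℕ.< n ℕ.+ n → (y : ∣ 2 ℕ.+ n ∣) → ∃ λ x → ⟦ L n ⟧ x ≈ᴹ y
    L-preimage n N<2n y with x , eq ← LΛ+c-surjective (suc N) n 0 (ℕ.m≤m+n (suc N) n) N<2n y =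
      ⟦ Λ n ⟧ x , ≈ᴹ-trans (≈ᴹ-sym (≈ᴹ-trans (+ᴹ-congˡ (*ₗ-zeroˡ x)) (+ᴹ-identityʳ _))) eq

  -- The commutator from creation and annihilation operators

  module Fock (d : ℕ)
    (B₀-trivial : (x : ∣ 0 ∣) → x ≈ᴹ 0ᴹ) (B₁-trivial : (x : ∣ 1 ∣) → x ≈ᴹ 0ᴹ)
    (ε : Word d → ∀ n → LinearMap (B n) (B (1 ℕ.+ n)))
    (ι : Word d → ∀ n → LinearMap (B (1 ℕ.+ n)) (B n))
    -- `g` plays the Kronecker delta. It is known only through its diagonal and through the sums
    -- that it collapses, so two words never have to be compared.
    (g : Word d → Word d → A) (g-diagonal : ∀ a → g a a ≈ 1#)
    (g-select : ∀ {n} b (f : Word d → ∣ n ∣) → Sum.∑ (B n) (λ a → g b a *ₗ f a) ≈ᴹ f b)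
    (ι-ε : ∀ a b n (x : ∣ 1 ℕ.+ n ∣) →
      ⟦ ι a (1 ℕ.+ n) ⟧ (⟦ ε b (1 ℕ.+ n) ⟧ x) ≈ᴹ g a b *ₗ x +ᴹ -ᴹ ⟦ ε b n ⟧ (⟦ ι a n ⟧ x))
    (ι-anticommute : ∀ a b n (x : ∣ 2 ℕ.+ n ∣) →
      ⟦ ι a n ⟧ (⟦ ι b (1 ℕ.+ n) ⟧ x) ≈ᴹ -ᴹ ⟦ ι b n ⟧ (⟦ ι a (1 ℕ.+ n) ⟧ x))
    (euler : ∀ n (x : ∣ 2 ℕ.+ n ∣) →
      Sum.∑ (B (2 ℕ.+ n)) (λ a → ⟦ ε a (1 ℕ.+ n) ⟧ (⟦ ι a (1 ℕ.+ n) ⟧ x)) ≈ᴹ nat n *ₗ x)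
    (s : Word d → A) (s-conj : ∀ a → s (conj a) ≈ - s a) (s-square : ∀ a → s a * s a ≈ 1#)
    where

    private
      module _ {n : ℕ} where
        open Sum (B n) public

    ι-square : ∀ a n (x : ∣ 2 ℕ.+ n ∣) → ⟦ ι a n ⟧ (⟦ ι a (1 ℕ.+ n) ⟧ x) ≈ᴹ 0ᴹ
    ι-square a n x = nat-torsion-free 1 (begin
      nat 2 *ₗ y                  ≈⟨ nat-+-*ₗ 1 1 y ⟩
      nat 1 *ₗ y +ᴹ nat 1 *ₗ y    ≈⟨ +ᴹ-cong 1y 1y ⟩
      y +ᴹ y                      ≈⟨ +ᴹ-congˡ (ι-anticommute a a n x) ⟩
      y +ᴹ -ᴹ y                   ≈⟨ -ᴹ‿inverseʳ y ⟩
      0ᴹ                          ∎)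
      where
      y = ⟦ ι a n ⟧ (⟦ ι a (1 ℕ.+ n) ⟧ x)
      1y : nat 1 *ₗ y ≈ᴹ y
      1y = ≈ᴹ-trans (*ₗ-congʳ (+-identityʳ 1#)) (*ₗ-identityˡ y)

    -- If ι_a may be nonzero on x, then ι_a x lies one degree lower and is moreover killed by ι_a,
    -- so it vanishes by induction and a can be dropped from the list.
    degree-bound : ∀ (as : List (Word d)) n → List.length as ℕ.< n → (x : ∣ 2 ℕ.+ n ∣) →
      (∀ b → b ∈ as ⊎ ⟦ ι b (1 ℕ.+ n) ⟧ x ≈ᴹ 0ᴹ) → x ≈ᴹ 0ᴹ
    -- With no word left every contraction kills x, hence so does the Euler operator; it also acts
    -- as multiplication by the degree, which is positive here.
    degree-bound [] (suc n) _ x killed = nat-torsion-free n (begin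
      nat (suc n) *ₗ x                                              ≈⟨ euler (suc n) x ⟨
      ∑ (λ a → ⟦ ε a (2 ℕ.+ n) ⟧ (⟦ ι a (2 ℕ.+ n) ⟧ x))             ≈⟨ ∑-0 term ⟩
      0ᴹ                                                            ∎)
      where
      term : ∀ a → ⟦ ε a (2 ℕ.+ n) ⟧ (⟦ ι a (2 ℕ.+ n) ⟧ x) ≈ᴹ 0ᴹ
      term a with killed a
      ... | inj₂ ιx≈0 = ≈ᴹ-trans (Lin.⟦⟧-cong (ε a _) ιx≈0) (Lin.0ᴹ-homo (ε a _))
    degree-bound (a ∷ as) (suc n) (ℕ.s≤s as<n) x killed =
      degree-bound as (suc n) (ℕ.m<n⇒m<1+n as<n) x killed′
      where
      ιx-killed : ∀ b → b ∈ as ⊎ ⟦ ι b (1 ℕ.+ n) ⟧ (⟦ ι a (2 ℕ.+ n) ⟧ x) ≈ᴹ 0ᴹ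
      ιx-killed b with killed b
      ... | inj₁ (here ≡.refl) = inj₂ (ι-square a _ x)
      ... | inj₁ (there b∈as)  = inj₁ b∈as
      ... | inj₂ ιx≈0          = inj₂ (begin
        ⟦ ι b _ ⟧ (⟦ ι a _ ⟧ x)       ≈⟨ ι-anticommute b a _ x ⟩
        -ᴹ ⟦ ι a _ ⟧ (⟦ ι b _ ⟧ x)    ≈⟨ -ᴹ‿cong (Lin.⟦⟧-cong (ι a _) ιx≈0) ⟩
        -ᴹ ⟦ ι a _ ⟧ 0ᴹ               ≈⟨ -ᴹ‿cong (Lin.0ᴹ-homo (ι a _)) ⟩
        -ᴹ 0ᴹ                         ≈⟨ -ᴹ0≈0 ⟩
        0ᴹ                            ∎)
      killed′ : ∀ b → b ∈ as ⊎ ⟦ ι b (2 ℕ.+ n) ⟧ x ≈ᴹ 0ᴹ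
      killed′ b with killed b
      ... | inj₁ (here ≡.refl) = inj₂ (degree-bound as n as<n _ ιx-killed)
      ... | inj₁ (there b∈as)  = inj₁ b∈as
      ... | inj₂ ιx≈0          = inj₂ ιx≈0

    raise : ∀ n → LinearMap (B n) (B (2 ℕ.+ n))
    raise n = ∑ₗ λ a → s a ·ₗ ε a (1 ℕ.+ n) ∘ₗ ε (conj a) n

    lower : ∀ n → LinearMap (B (2 ℕ.+ n)) (B n)
    lower n = ∑ₗ λ b → s b ·ₗ ι (conj b) n ∘ₗ ι b (1 ℕ.+ n)

    -- Moving ι_b past both factors of s_a ε_a ε_ā leaves one term at a = b and one at a = b̄. The
    -- latter acquires a minus sign from the factor already passed, and `s-conj` turns it back into
    -- a plus, so the two terms add up to 2 s_b ε_b̄. If s were invariant under complementation they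
    -- would cancel.
    ι-raise : ∀ b n (x : ∣ 1 ℕ.+ n ∣) →
      ⟦ ι b (2 ℕ.+ n) ⟧ (⟦ raise (1 ℕ.+ n) ⟧ x) ≈ᴹ
      ⟦ raise n ⟧ (⟦ ι b n ⟧ x) +ᴹ (s b + s b) *ₗ ⟦ ε (conj b) (1 ℕ.+ n) ⟧ x
    ι-raise b n x = begin
      ⟦ ι b _ ⟧ (⟦ raise _ ⟧ x)
        ≈⟨ ∑-homo (ι b _) (λ a → s a *ₗ ⟦ ε a _ ⟧ (⟦ ε (conj a) _ ⟧ x)) ⟩
      ∑ (λ a → ⟦ ι b _ ⟧ (s a *ₗ ⟦ ε a _ ⟧ (⟦ ε (conj a) _ ⟧ x)))
        ≈⟨ ∑-cong term ⟩
      ∑ (λ a → s a *ₗ Z a +ᴹ (g b a *ₗ H a +ᴹ g b (conj a) *ₗ H (conj a)))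
        ≈⟨ ∑-+ (λ a → s a *ₗ Z a) (λ a → g b a *ₗ H a +ᴹ g b (conj a) *ₗ H (conj a)) ⟩
      ⟦ raise n ⟧ (⟦ ι b n ⟧ x) +ᴹ ∑ (λ a → g b a *ₗ H a +ᴹ g b (conj a) *ₗ H (conj a))
        ≈⟨ +ᴹ-congˡ (∑-+ (λ a → g b a *ₗ H a) (λ a → g b (conj a) *ₗ H (conj a))) ⟩
      ⟦ raise n ⟧ (⟦ ι b n ⟧ x) +ᴹ (∑ (λ a → g b a *ₗ H a) +ᴹ ∑ (λ a → g b (conj a) *ₗ H (conj a)))
        ≈⟨ +ᴹ-congˡ (+ᴹ-cong (g-select b H)
             (≈ᴹ-trans (∑-conj (λ a → g b a *ₗ H a)) (g-select b H))) ⟩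
      ⟦ raise n ⟧ (⟦ ι b n ⟧ x) +ᴹ (H b +ᴹ H b)
        ≈⟨ +ᴹ-congˡ (*ₗ-distribʳ _ (s b) (s b)) ⟨
      ⟦ raise n ⟧ (⟦ ι b n ⟧ x) +ᴹ (s b + s b) *ₗ ⟦ ε (conj b) (1 ℕ.+ n) ⟧ x ∎
      where
      H Z : Word d → ∣ 2 ℕ.+ n ∣
      H a = s a *ₗ ⟦ ε (conj a) (1 ℕ.+ n) ⟧ x
      Z a = ⟦ ε a (1 ℕ.+ n) ⟧ (⟦ ε (conj a) n ⟧ (⟦ ι b n ⟧ x))
      scale-swap : ∀ p q (y : ∣ 2 ℕ.+ n ∣) → p *ₗ q *ₗ y ≈ᴹ q *ₗ p *ₗ y
      scale-swap p q y = ≈ᴹ-trans (≈ᴹ-sym (*ₗ-assoc p q y))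
        (≈ᴹ-trans (*ₗ-congʳ (*-comm p q)) (*ₗ-assoc q p y))
      ε-swap : ∀ a → - s a *ₗ ⟦ ε a (1 ℕ.+ n) ⟧ x ≈ᴹ H (conj a)
      ε-swap a = begin
        - s a *ₗ ⟦ ε a _ ⟧ x
          ≈⟨ *ₗ-congʳ (s-conj a) ⟨
        s (conj a) *ₗ ⟦ ε a _ ⟧ x
          ≡⟨ ≡.cong (λ w → s (conj a) *ₗ ⟦ ε w (1 ℕ.+ n) ⟧ x) (conj-involutive a) ⟨
        H (conj a) ∎
      term : ∀ a → ⟦ ι b _ ⟧ (s a *ₗ ⟦ ε a _ ⟧ (⟦ ε (conj a) _ ⟧ x)) ≈ᴹ
                   s a *ₗ Z a +ᴹ (g b a *ₗ H a +ᴹ g b (conj a) *ₗ H (conj a))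
      term a = begin
        ⟦ ι b _ ⟧ (s a *ₗ ⟦ ε a _ ⟧ (⟦ ε ā _ ⟧ x))
          ≈⟨ Lin.*ₗ-homo (ι b _) (s a) _ ⟩
        s a *ₗ ⟦ ι b _ ⟧ (⟦ ε a _ ⟧ (⟦ ε ā _ ⟧ x))
          ≈⟨ *ₗ-congˡ (ι-ε b a _ _) ⟩
        s a *ₗ (g b a *ₗ ⟦ ε ā _ ⟧ x +ᴹ -ᴹ ⟦ ε a _ ⟧ (⟦ ι b _ ⟧ (⟦ ε ā _ ⟧ x)))
          ≈⟨ *ₗ-congˡ (+ᴹ-congˡ (-ᴹ‿cong inner)) ⟩
        s a *ₗ (g b a *ₗ ⟦ ε ā _ ⟧ x +ᴹ -ᴹ (g b ā *ₗ ⟦ ε a _ ⟧ x +ᴹ -ᴹ Z a))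
          ≈⟨ *ₗ-congˡ (+ᴹ-congˡ (≈ᴹ-trans (≈ᴹ-sym (-ᴹ-+ᴹ-comm _ _)) (+ᴹ-congˡ (-ᴹ-involutive _)))) ⟩
        s a *ₗ (g b a *ₗ ⟦ ε ā _ ⟧ x +ᴹ (-ᴹ (g b ā *ₗ ⟦ ε a _ ⟧ x) +ᴹ Z a))
          ≈⟨ *ₗ-congˡ (≈ᴹ-trans (≈ᴹ-sym (+ᴹ-assoc _ _ _)) (+ᴹ-comm _ _)) ⟩
        s a *ₗ (Z a +ᴹ (g b a *ₗ ⟦ ε ā _ ⟧ x +ᴹ -ᴹ (g b ā *ₗ ⟦ ε a _ ⟧ x)))
          ≈⟨ ≈ᴹ-trans (*ₗ-distribˡ (s a) _ _) (+ᴹ-congˡ (*ₗ-distribˡ (s a) _ _)) ⟩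
        s a *ₗ Z a +ᴹ (s a *ₗ g b a *ₗ ⟦ ε ā _ ⟧ x +ᴹ s a *ₗ (-ᴹ (g b ā *ₗ ⟦ ε a _ ⟧ x)))
          ≈⟨ +ᴹ-congˡ (+ᴹ-cong (scale-swap (s a) (g b a) _) (begin
               s a *ₗ (-ᴹ (g b ā *ₗ ⟦ ε a _ ⟧ x))  ≈⟨ *ₗ‿-ᴹ (s a) _ ⟩
               -ᴹ (s a *ₗ g b ā *ₗ ⟦ ε a _ ⟧ x)    ≈⟨ -ᴹ‿*ₗ (s a) _ ⟨
               - s a *ₗ g b ā *ₗ ⟦ ε a _ ⟧ x       ≈⟨ scale-swap (- s a) (g b ā) _ ⟩
               g b ā *ₗ - s a *ₗ ⟦ ε a _ ⟧ x       ≈⟨ *ₗ-congˡ (ε-swap a) ⟩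
               g b ā *ₗ H ā                        ∎)) ⟩
        s a *ₗ Z a +ᴹ (g b a *ₗ H a +ᴹ g b ā *ₗ H ā) ∎
        where
        ā = conj a
        inner : ⟦ ε a (1 ℕ.+ n) ⟧ (⟦ ι b (1 ℕ.+ n) ⟧ (⟦ ε ā (1 ℕ.+ n) ⟧ x)) ≈ᴹ
                g b ā *ₗ ⟦ ε a (1 ℕ.+ n) ⟧ x +ᴹ -ᴹ Z a
        inner = begin
          ⟦ ε a _ ⟧ (⟦ ι b _ ⟧ (⟦ ε ā _ ⟧ x))
            ≈⟨ Lin.⟦⟧-cong (ε a _) (ι-ε b ā n x) ⟩
          ⟦ ε a _ ⟧ (g b ā *ₗ x +ᴹ -ᴹ ⟦ ε ā _ ⟧ (⟦ ι b _ ⟧ x))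
            ≈⟨ Lin.+ᴹ-homo (ε a _) _ _ ⟩
          ⟦ ε a _ ⟧ (g b ā *ₗ x) +ᴹ ⟦ ε a _ ⟧ (-ᴹ ⟦ ε ā _ ⟧ (⟦ ι b _ ⟧ x))
            ≈⟨ +ᴹ-cong (Lin.*ₗ-homo (ε a _) _ _) (Lin.-ᴹ-homo (ε a _) _) ⟩
          g b ā *ₗ ⟦ ε a _ ⟧ x +ᴹ -ᴹ Z a ∎

    private
      two : A
      two = 1# + 1#

    s-twice : ∀ a → s a * (s a + s a) ≈ two
    s-twice a = trans (distribˡ (s a) (s a) (s a)) (+-cong (s-square a) (s-square a))

    s-twice-conj : ∀ a → s a * (s (conj a) + s (conj a)) ≈ - two
    s-twice-conj a = trans (*-congˡ (trans (+-cong (s-conj a) (s-conj a)) (-‿+-comm (s a) (s a))))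
      (trans (sym (-‿distribʳ-* (s a) (s a + s a))) (-‿cong (s-twice a)))
      where open RingProperties ring

    cancel-pair : ∀ {n} (u v p q : ∣ n ∣) → u +ᴹ (-ᴹ p +ᴹ (v +ᴹ -ᴹ q)) +ᴹ (p +ᴹ q) ≈ᴹ u +ᴹ v
    cancel-pair u v p q = begin
      u +ᴹ (-ᴹ p +ᴹ (v +ᴹ -ᴹ q)) +ᴹ (p +ᴹ q)      ≈⟨ +ᴹ-assoc _ _ _ ⟩
      u +ᴹ (-ᴹ p +ᴹ (v +ᴹ -ᴹ q) +ᴹ (p +ᴹ q))      ≈⟨ +ᴹ-congˡ (+ᴹ-interchange _ _ _ _) ⟩
      u +ᴹ (-ᴹ p +ᴹ p +ᴹ (v +ᴹ -ᴹ q +ᴹ q))        ≈⟨ +ᴹ-congˡ (+ᴹ-cong (-ᴹ‿inverseˡ p)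
                                                       (≈ᴹ-trans (+ᴹ-assoc _ _ _) (+ᴹ-congˡ (-ᴹ‿inverseˡ q)))) ⟩
      u +ᴹ (0ᴹ +ᴹ (v +ᴹ 0ᴹ))                      ≈⟨ +ᴹ-congˡ (≈ᴹ-trans (+ᴹ-identityˡ _) (+ᴹ-identityʳ v)) ⟩
      u +ᴹ v                                      ∎

    -- Two applications of `ι-raise` commute ι_b̄ ι_b past `raise`. After multiplication by s_b the
    -- correction is 2 - 2 ε_b ι_b - 2 ε_b̄ ι_b̄, because s_b squares to 1 and s_b̄ = -s_b. Over all
    -- words the constants give 2 · 2^d and each of the other two families gives 2n by `euler`. The
    -- common factor 2 is removed in `half-lower`.
    lower-raise : ∀ n (x : ∣ 2 ℕ.+ n ∣) →
      ⟦ lower (2 ℕ.+ n) ⟧ (⟦ raise (2 ℕ.+ n) ⟧ x) +ᴹ two *ₗ nat (n ℕ.+ n) *ₗ x ≈ᴹ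
      ⟦ raise n ⟧ (⟦ lower n ⟧ x) +ᴹ two *ₗ nat (2 ℕ.^ d) *ₗ x
    lower-raise n x = begin
      ∑ T +ᴹ two *ₗ nat (n ℕ.+ n) *ₗ x
        ≈⟨ +ᴹ-congˡ (*ₗ-congˡ (nat-+-*ₗ n n x)) ⟩
      ∑ T +ᴹ two *ₗ (nat n *ₗ x +ᴹ nat n *ₗ x)
        -- The multiple 2n of x is written as two Euler sums, one reindexed by complementation, so
        -- that the identity can be checked one word at a time.
        ≈⟨ +ᴹ-congˡ (*ₗ-congˡ (+ᴹ-cong (euler n x) (≈ᴹ-trans (∑-conj P) (euler n x)))) ⟨
      ∑ T +ᴹ two *ₗ (∑ P +ᴹ ∑ (P ∘ conj))
        ≈⟨ +ᴹ-congˡ (*ₗ-congˡ (∑-+ P (P ∘ conj))) ⟨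
      ∑ T +ᴹ two *ₗ ∑ (λ b → P b +ᴹ P (conj b))
        ≈⟨ +ᴹ-congˡ (∑-* two (λ b → P b +ᴹ P (conj b))) ⟨
      ∑ T +ᴹ ∑ (λ b → two *ₗ (P b +ᴹ P (conj b)))
        ≈⟨ ∑-+ T (λ b → two *ₗ (P b +ᴹ P (conj b))) ⟨
      ∑ (λ b → T b +ᴹ two *ₗ (P b +ᴹ P (conj b)))
        ≈⟨ ∑-cong term ⟩
      ∑ (λ b → ⟦ raise n ⟧ (Q b) +ᴹ two *ₗ x)
        ≈⟨ ∑-+ (λ b → ⟦ raise n ⟧ (Q b)) (λ _ → two *ₗ x) ⟩
      ∑ (λ b → ⟦ raise n ⟧ (Q b)) +ᴹ ∑ {d = d} (λ _ → two *ₗ x)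
        ≈⟨ +ᴹ-cong (≈ᴹ-sym (∑-homo (raise n) Q)) (∑-* {d = d} two (λ _ → x)) ⟩
      ⟦ raise n ⟧ (⟦ lower n ⟧ x) +ᴹ two *ₗ ∑ {d = d} (λ _ → x)
        ≈⟨ +ᴹ-congˡ (*ₗ-congˡ (∑-const d x)) ⟩
      ⟦ raise n ⟧ (⟦ lower n ⟧ x) +ᴹ two *ₗ nat (2 ℕ.^ d) *ₗ x ∎
      where
      P T : Word d → ∣ 2 ℕ.+ n ∣
      P b = ⟦ ε b (1 ℕ.+ n) ⟧ (⟦ ι b (1 ℕ.+ n) ⟧ x)
      T b = s b *ₗ ⟦ ι (conj b) (2 ℕ.+ n) ⟧ (⟦ ι b (3 ℕ.+ n) ⟧ (⟦ raise (2 ℕ.+ n) ⟧ x))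
      Q : Word d → ∣ n ∣
      Q b = s b *ₗ ⟦ ι (conj b) n ⟧ (⟦ ι b (1 ℕ.+ n) ⟧ x)
      term : ∀ b → T b +ᴹ two *ₗ (P b +ᴹ P (conj b)) ≈ᴹ ⟦ raise n ⟧ (Q b) +ᴹ two *ₗ x
      term b = begin
        T b +ᴹ two *ₗ (P b +ᴹ P b̄)
          ≈⟨ +ᴹ-cong (*ₗ-congˡ expand) (*ₗ-distribˡ two _ _) ⟩
        s b *ₗ (ρ +ᴹ (c₁ *ₗ P b +ᴹ c₂ *ₗ (x +ᴹ -ᴹ P b̄))) +ᴹ (two *ₗ P b +ᴹ two *ₗ P b̄)
          ≈⟨ +ᴹ-congʳ (≈ᴹ-trans (*ₗ-distribˡ (s b) _ _) (+ᴹ-congˡ (*ₗ-distribˡ (s b) _ _))) ⟩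
        s b *ₗ ρ +ᴹ (s b *ₗ c₁ *ₗ P b +ᴹ s b *ₗ c₂ *ₗ (x +ᴹ -ᴹ P b̄)) +ᴹ (two *ₗ P b +ᴹ two *ₗ P b̄)
          ≈⟨ +ᴹ-congʳ (+ᴹ-cong (≈ᴹ-sym (Lin.*ₗ-homo (raise n) (s b) _)) (+ᴹ-cong
               (≈ᴹ-trans (≈ᴹ-sym (*ₗ-assoc (s b) c₁ (P b)))
                 (≈ᴹ-trans (*ₗ-congʳ (s-twice-conj b)) (-ᴹ‿*ₗ two (P b))))
               (≈ᴹ-trans (≈ᴹ-sym (*ₗ-assoc (s b) c₂ _)) (≈ᴹ-trans (*ₗ-congʳ (s-twice b))
                 (≈ᴹ-trans (*ₗ-distribˡ two x _) (+ᴹ-congˡ (*ₗ‿-ᴹ two (P b̄)))))))) ⟩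
        ⟦ raise n ⟧ (Q b) +ᴹ (-ᴹ (two *ₗ P b) +ᴹ (two *ₗ x +ᴹ -ᴹ (two *ₗ P b̄)))
          +ᴹ (two *ₗ P b +ᴹ two *ₗ P b̄)
          ≈⟨ cancel-pair _ _ _ _ ⟩
        ⟦ raise n ⟧ (Q b) +ᴹ two *ₗ x ∎
        where
        b̄ = conj b
        c₁ c₂ : A
        c₁ = s b̄ + s b̄
        c₂ = s b + s b
        ρ = ⟦ raise n ⟧ (⟦ ι b̄ n ⟧ (⟦ ι b (1 ℕ.+ n) ⟧ x))
        expand : ⟦ ι b̄ (2 ℕ.+ n) ⟧ (⟦ ι b (3 ℕ.+ n) ⟧ (⟦ raise (2 ℕ.+ n) ⟧ x)) ≈ᴹ
                 ρ +ᴹ (c₁ *ₗ P b +ᴹ c₂ *ₗ (x +ᴹ -ᴹ P b̄))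
        expand = begin
          ⟦ ι b̄ _ ⟧ (⟦ ι b _ ⟧ (⟦ raise _ ⟧ x))
            ≈⟨ Lin.⟦⟧-cong (ι b̄ _) (ι-raise b (1 ℕ.+ n) x) ⟩
          ⟦ ι b̄ _ ⟧ (⟦ raise _ ⟧ (⟦ ι b _ ⟧ x) +ᴹ c₂ *ₗ ⟦ ε b̄ _ ⟧ x)
            ≈⟨ ≈ᴹ-trans (Lin.+ᴹ-homo (ι b̄ _) _ _) (+ᴹ-congˡ (Lin.*ₗ-homo (ι b̄ _) c₂ _)) ⟩
          ⟦ ι b̄ _ ⟧ (⟦ raise _ ⟧ (⟦ ι b _ ⟧ x)) +ᴹ c₂ *ₗ ⟦ ι b̄ _ ⟧ (⟦ ε b̄ _ ⟧ x)
            ≈⟨ +ᴹ-cong (ι-raise b̄ n (⟦ ι b _ ⟧ x)) (*ₗ-congˡ (≈ᴹ-trans (ι-ε b̄ b̄ _ x)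
                 (+ᴹ-congʳ (≈ᴹ-trans (*ₗ-congʳ (g-diagonal b̄)) (*ₗ-identityˡ x))))) ⟩
          ρ +ᴹ c₁ *ₗ ⟦ ε (conj b̄) _ ⟧ (⟦ ι b _ ⟧ x) +ᴹ c₂ *ₗ (x +ᴹ -ᴹ P b̄)
            ≡⟨ ≡.cong (λ w → ρ +ᴹ c₁ *ₗ ⟦ ε w (1 ℕ.+ n) ⟧ (⟦ ι b (1 ℕ.+ n) ⟧ x) +ᴹ c₂ *ₗ (x +ᴹ -ᴹ P b̄))
                 (conj-involutive b) ⟩
          ρ +ᴹ c₁ *ₗ P b +ᴹ c₂ *ₗ (x +ᴹ -ᴹ P b̄)
            ≈⟨ +ᴹ-assoc _ _ _ ⟩
          ρ +ᴹ (c₁ *ₗ P b +ᴹ c₂ *ₗ (x +ᴹ -ᴹ P b̄)) ∎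

    private
      half : A
      half = proj₁ (nat-inverse 1)

      half-two : ∀ {n} (x : ∣ n ∣) → half *ₗ two *ₗ x ≈ᴹ x
      half-two x = begin
        half *ₗ two *ₗ x       ≈⟨ *ₗ-assoc half two x ⟨
        (half * two) *ₗ x      ≈⟨ *ₗ-congʳ (trans (*-congˡ (+-congˡ (sym (+-identityʳ 1#))))
                                                  (proj₂ (nat-inverse 1))) ⟩
        1# *ₗ x                ≈⟨ *ₗ-identityˡ x ⟩
        x                      ∎

    half-lower : ∀ n → LinearMap (B (2 ℕ.+ n)) (B n)
    half-lower n = half ·ₗ lower n

    -- [half-lower , raise] = 2ᵈ - 2n, with the negative term moved to the left.
    half-lower-raise : ∀ n (x : ∣ 2 ℕ.+ n ∣) →
      ⟦ half-lower (2 ℕ.+ n) ⟧ (⟦ raise (2 ℕ.+ n) ⟧ x) +ᴹ nat (n ℕ.+ n) *ₗ x ≈ᴹ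
      ⟦ raise n ⟧ (⟦ half-lower n ⟧ x) +ᴹ nat (2 ℕ.^ d) *ₗ x
    half-lower-raise n x = begin
      half *ₗ ⟦ lower _ ⟧ (⟦ raise _ ⟧ x) +ᴹ nat (n ℕ.+ n) *ₗ x
        ≈⟨ +ᴹ-congˡ (half-two _) ⟨
      half *ₗ ⟦ lower _ ⟧ (⟦ raise _ ⟧ x) +ᴹ half *ₗ two *ₗ nat (n ℕ.+ n) *ₗ x
        ≈⟨ *ₗ-distribˡ half _ _ ⟨
      half *ₗ (⟦ lower _ ⟧ (⟦ raise _ ⟧ x) +ᴹ two *ₗ nat (n ℕ.+ n) *ₗ x)
        ≈⟨ *ₗ-congˡ (lower-raise n x) ⟩
      half *ₗ (⟦ raise _ ⟧ (⟦ lower _ ⟧ x) +ᴹ two *ₗ nat (2 ℕ.^ d) *ₗ x)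
        ≈⟨ *ₗ-distribˡ half _ _ ⟩
      half *ₗ ⟦ raise _ ⟧ (⟦ lower _ ⟧ x) +ᴹ half *ₗ two *ₗ nat (2 ℕ.^ d) *ₗ x
        ≈⟨ +ᴹ-cong (≈ᴹ-sym (Lin.*ₗ-homo (raise n) half _)) (half-two _) ⟩
      ⟦ raise n ⟧ (⟦ half-lower n ⟧ x) +ᴹ nat (2 ℕ.^ d) *ₗ x ∎

    words : ∀ k → List (Word k)
    words = tuples (0F ∷ 1F ∷ [])

    ∈-words : ∀ {k} (a : Word k) → a ∈ words k
    ∈-words []       = here ≡.refl
    ∈-words (i ∷ a) = ∈-cartesianProductWith⁺ _∷_ (∈-letters i) (∈-words a)
      where
      ∈-letters : (i : Fin 2) → i ∈ 0F ∷ 1F ∷ []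
      ∈-letters 0F = here ≡.refl
      ∈-letters 1F = there (here ≡.refl)

    length-words : ∀ k → List.length (words k) ≡ 2 ℕ.^ k
    length-words zero    = ≡.refl
    length-words (suc k)
      rewrite List.length-++ (List.map {B = Word (suc k)} (0F ∷_) (words k))
                        {List.map (1F ∷_) (words k) List.++ []}
            | List.length-++ (List.map {B = Word (suc k)} (1F ∷_) (words k)) {[]}
            | List.length-map {B = Word (suc k)} (0F ∷_) (words k)
            | List.length-map {B = Word (suc k)} (1F ∷_) (words k)
            | length-words k = ≡.refl

    open SL₂ B₀-trivial B₁-trivial raise half-lower (2 ℕ.^ d)
      -- At the start no contraction is known to kill x, so all 2^d words are listed; their number
      -- is the degree beyond which everything vanishes.
      (λ n 2ᵈ<n x → degree-bound (words d) n
        (≡.subst (ℕ._< n) (≡.sym (length-words d)) 2ᵈ<n) x (inj₁ ∘ ∈-words))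
      half-lower-raise public using ()
      renaming (L-kernel to raise-kernel; L-preimage to raise-preimage)

-- Contractions of the exterior algebra

module FreeModules {c ℓ : Level} (R : CommutativeRing c ℓ) where

  open CommutativeRing R renaming (Carrier to A)
  open LinearMaps R
  open Multilinear R
  open LinearMap using (⟦_⟧)

  module _ {x n ℓn : Level} {X : Set x} (N : Module R n ℓn)
           (f : X → Module.Carrierᴹ N) where

    open Mod N

    lift : Free X → Carrierᴹ
    lift ⟨ x ⟩   = f x
    lift 𝟘       = 0ᴹ
    lift (s ⊕ t) = lift s +ᴹ lift t
    lift (⊖ s)   = -ᴹ lift s
    lift (a ⊙ s) = a *ₗ lift s

    module _ {ρ : Level} {_~_ : Rel (Free X) ρ}
             (resp : ∀ {s t} → s ~ t → lift s ≈ᴹ lift t) where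

      lift-cong : ∀ {s t} → Generated _~_ s t → lift s ≈ᴹ lift t
      lift-cong (rel p)            = resp p
      lift-cong reflexive          = ≈ᴹ-refl
      lift-cong (symmetric p)      = ≈ᴹ-sym (lift-cong p)
      lift-cong (transitive p q)   = ≈ᴹ-trans (lift-cong p) (lift-cong q)
      lift-cong (⊕-cong p q)       = +ᴹ-cong (lift-cong p) (lift-cong q)
      lift-cong (⊖-cong p)         = -ᴹ‿cong (lift-cong p)
      lift-cong (⊙-cong a p)       = *ₗ-cong a (lift-cong p)
      lift-cong (⊕-assoc s t u)    = +ᴹ-assoc _ _ _
      lift-cong (⊕-comm s t)       = +ᴹ-comm _ _
      lift-cong (⊕-identityˡ s)    = +ᴹ-identityˡ _
      lift-cong (⊖-inverseˡ s)     = -ᴹ‿inverseˡ _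
      lift-cong (⊙-zeroˡ s)        = *ₗ-zeroˡ _
      lift-cong (⊙-zeroʳ a)        = *ₗ-zeroʳ a
      lift-cong (⊙-identityˡ s)    = *ₗ-identityˡ _
      lift-cong (⊙-assoc a b s)    = *ₗ-assoc a b _
      lift-cong (⊙-distribˡ a s t) = *ₗ-distribˡ a _ _
      lift-cong (⊙-distribʳ s a b) = *ₗ-distribʳ _ a b

      liftₗ : LinearMap (Free/ _~_) N
      liftₗ = linear (Free/ _~_) N lift lift-cong (λ _ _ → ≈ᴹ-refl) (λ _ _ → ≈ᴹ-refl)

  module _ {x n ℓn ρ : Level} {X : Set x} {_~_ : Rel (Free X) ρ} {N : Module R n ℓn}
           (F G : LinearMap (Free/ _~_) N) where

    open Mod N
    private
      module F = Lin F
      module G = Lin G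

    -- This reduces operator identities on ⋀ⁿ to single wedges, where induction on the number of
    -- factors is available.
    agree-on-generators : (∀ x → ⟦ F ⟧ ⟨ x ⟩ ≈ᴹ ⟦ G ⟧ ⟨ x ⟩) → ∀ s → ⟦ F ⟧ s ≈ᴹ ⟦ G ⟧ s
    agree-on-generators eq ⟨ x ⟩   = eq x
    agree-on-generators eq 𝟘       = ≈ᴹ-trans F.0ᴹ-homo (≈ᴹ-sym G.0ᴹ-homo)
    agree-on-generators eq (s ⊕ t) = ≈ᴹ-trans (F.+ᴹ-homo s t) (≈ᴹ-trans
      (+ᴹ-cong (agree-on-generators eq s) (agree-on-generators eq t)) (≈ᴹ-sym (G.+ᴹ-homo s t)))
    agree-on-generators eq (⊖ s)   = ≈ᴹ-trans (F.-ᴹ-homo s) (≈ᴹ-trans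
      (-ᴹ‿cong (agree-on-generators eq s)) (≈ᴹ-sym (G.-ᴹ-homo s)))
    agree-on-generators eq (a ⊙ s) = ≈ᴹ-trans (F.*ₗ-homo a s) (≈ᴹ-trans
      (*ₗ-congˡ (agree-on-generators eq s)) (≈ᴹ-sym (G.*ₗ-homo a s)))

module Exterior {c ℓ m ℓm : Level} (R : CommutativeRing c ℓ) (M : Module R m ℓm) where

  open CommutativeRing R renaming (Carrier to A)
  open LinearMaps R
  open FreeModules R
  open Multilinear R hiding (_∧_)
  open LinearMap using (⟦_⟧)
  module M = Module M

  private
    module _ {n : ℕ} where
      open Mod (⋀ n M) public hiding (Carrierᴹ)
    ⋀ᶜ : ℕ → Set (c ⊔ m)
    ⋀ᶜ n = Free (Vec M.Carrierᴹ n)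

  infixr 8 _∧_
  _∧_ : ∀ {n} → M.Carrierᴹ → ⋀ᶜ n → ⋀ᶜ (suc n)
  v ∧ x = mapFree (v ∷_) x

  v∧ : M.Carrierᴹ → ∀ n → LinearMap (⋀ n M) (⋀ (suc n) M)
  v∧ v n = wedge ⟨ v ∷ [] ⟩ n

  ∧x : ∀ {n} → ⋀ᶜ n → LinearMap M (⋀ (suc n) M)
  ∧x {n} x = linear M (⋀ (suc n) M) (_∧ x)
    (λ {u} {v} u≈v → ∧-congʳ M 1 n {⟨ u ∷ [] ⟩} {⟨ v ∷ [] ⟩} (rel (multilinear (congruent (u≈v ∷ [])))) x)
    (λ u v → ∧-congʳ M 1 n {⟨ u M.+ᴹ v ∷ [] ⟩} {⟨ u ∷ [] ⟩ ⊕ ⟨ v ∷ [] ⟩}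
      (rel (multilinear (additive (u ∷ []) 0F u v))) x)
    (λ a u → ∧-congʳ M 1 n {⟨ a M.*ₗ u ∷ [] ⟩} {a ⊙ ⟨ u ∷ [] ⟩}
      (rel (multilinear (homogeneous (u ∷ []) 0F a u))) x)

  ∧-square : ∀ {n} v (x : ⋀ᶜ n) → v ∧ v ∧ x ≈ᴹ 𝟘
  ∧-square {n} v = agree-on-generators (v∧ v (suc n) ∘ₗ v∧ v n) zeroₗ
    λ us → rel (repeated (v ∷ v ∷ us) 0F 1F (λ ()) M.≈ᴹ-refl)

  ∧-anticommute : ∀ {n} u v (x : ⋀ᶜ n) → u ∧ v ∧ x ≈ᴹ ⊖ (v ∧ u ∧ x)
  ∧-anticommute {n} u v x = -ᴹ-uniqueˡ _ _ (begin
    u ∧ v ∧ x ⊕ v ∧ u ∧ x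
      ≈⟨ +ᴹ-cong (≈ᴹ-trans (+ᴹ-congʳ (∧-square u x)) (+ᴹ-identityˡ _))
                 (≈ᴹ-trans (+ᴹ-congˡ (∧-square v x)) (+ᴹ-identityʳ _)) ⟨
    (u ∧ u ∧ x ⊕ u ∧ v ∧ x) ⊕ (v ∧ u ∧ x ⊕ v ∧ v ∧ x)
      ≈⟨ +ᴹ-cong (Lin.+ᴹ-homo (v∧ u _) (u ∧ x) (v ∧ x)) (Lin.+ᴹ-homo (v∧ v _) (u ∧ x) (v ∧ x)) ⟨
    (u ∧ (u ∧ x ⊕ v ∧ x)) ⊕ (v ∧ (u ∧ x ⊕ v ∧ x))
      ≈⟨ Lin.+ᴹ-homo (∧x (u ∧ x ⊕ v ∧ x)) u v ⟨
    (u M.+ᴹ v) ∧ (u ∧ x ⊕ v ∧ x)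
      ≈⟨ Lin.⟦⟧-cong (v∧ (u M.+ᴹ v) _) (Lin.+ᴹ-homo (∧x x) u v) ⟨
    (u M.+ᴹ v) ∧ (u M.+ᴹ v) ∧ x
      ≈⟨ ∧-square (u M.+ᴹ v) x ⟩
    𝟘 ∎)

  module Contraction (φ : LinearMap M scalars) where

    private
      ∣φ∣ = ⟦ φ ⟧
      module φ = Lin φ

    -- `contract us` is v ↦ ι_φ(v ∧ us). Keeping the head as the argument of a bundled linear map
    -- makes the contraction congruent, additive and homogeneous in the first slot by construction.
    contract : ∀ {n} → Vec M.Carrierᴹ n → LinearMap M (⋀ n M)
    contract []       = φ ▹ ⟨ [] ⟩
    contract (u ∷ us) = (φ ▹ ⟨ u ∷ us ⟩) +ₗ (-ₗ ∧x (⟦ contract us ⟧ u))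

    contractᵛ : ∀ {n} → Vec M.Carrierᴹ (suc n) → ⋀ᶜ n
    contractᵛ (v ∷ vs) = ⟦ contract vs ⟧ v

    contractᶠ : ∀ {n} → ⋀ᶜ (suc n) → ⋀ᶜ n
    contractᶠ {n} = lift (⋀ n M) contractᵛ

    -- The antiderivation rule is needed to show that `contractᶠ` respects the relations, so it
    -- cannot presuppose this. It is proved for formal combinations, by recursion on the expression;
    -- on a single wedge it is the definition.
    contractᶠ-∧ : ∀ {n} v (x : ⋀ᶜ (suc n)) →
                  contractᶠ (v ∧ x) ≈ᴹ (∣φ∣ v ⊙ x) ⊕ (⊖ (v ∧ contractᶠ x))
    contractᶠ-∧ v ⟨ u ∷ us ⟩ = ≈ᴹ-refl
    contractᶠ-∧ v 𝟘       = ≈ᴹ-sym (≈ᴹ-trans (+ᴹ-cong (*ₗ-zeroʳ _) -ᴹ0≈0) (+ᴹ-identityˡ 𝟘))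
    contractᶠ-∧ v (s ⊕ t) = begin
      contractᶠ (v ∧ s) ⊕ contractᶠ (v ∧ t)
        ≈⟨ +ᴹ-cong (contractᶠ-∧ v s) (contractᶠ-∧ v t) ⟩
      ((∣φ∣ v ⊙ s) ⊕ (⊖ (v ∧ contractᶠ s))) ⊕ ((∣φ∣ v ⊙ t) ⊕ (⊖ (v ∧ contractᶠ t)))
        ≈⟨ +ᴹ-interchange _ _ _ _ ⟩
      ((∣φ∣ v ⊙ s) ⊕ (∣φ∣ v ⊙ t)) ⊕ ((⊖ (v ∧ contractᶠ s)) ⊕ (⊖ (v ∧ contractᶠ t)))
        ≈⟨ +ᴹ-cong (≈ᴹ-sym (*ₗ-distribˡ _ s t)) (-ᴹ-+ᴹ-comm _ _) ⟩
      (∣φ∣ v ⊙ (s ⊕ t)) ⊕ (⊖ (v ∧ contractᶠ (s ⊕ t))) ∎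
    contractᶠ-∧ v (⊖ s)   = begin
      ⊖ contractᶠ (v ∧ s)                              ≈⟨ -ᴹ‿cong (contractᶠ-∧ v s) ⟩
      ⊖ ((∣φ∣ v ⊙ s) ⊕ (⊖ (v ∧ contractᶠ s)))          ≈⟨ -ᴹ-+ᴹ-comm _ _ ⟨
      (⊖ (∣φ∣ v ⊙ s)) ⊕ (⊖ ⊖ (v ∧ contractᶠ s))        ≈⟨ +ᴹ-congʳ (*ₗ‿-ᴹ _ s) ⟨
      (∣φ∣ v ⊙ ⊖ s) ⊕ (⊖ (v ∧ contractᶠ (⊖ s)))        ∎
    contractᶠ-∧ v (a ⊙ s) = begin
      a ⊙ contractᶠ (v ∧ s)                            ≈⟨ *ₗ-congˡ (contractᶠ-∧ v s) ⟩
      a ⊙ ((∣φ∣ v ⊙ s) ⊕ (⊖ (v ∧ contractᶠ s)))        ≈⟨ *ₗ-distribˡ a _ _ ⟩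
      (a ⊙ ∣φ∣ v ⊙ s) ⊕ (a ⊙ ⊖ (v ∧ contractᶠ s))      ≈⟨ +ᴹ-cong swap (*ₗ‿-ᴹ a _) ⟩
      (∣φ∣ v ⊙ a ⊙ s) ⊕ (⊖ (v ∧ contractᶠ (a ⊙ s)))    ∎
      where
      swap : a ⊙ ∣φ∣ v ⊙ s ≈ᴹ ∣φ∣ v ⊙ a ⊙ s
      swap = ≈ᴹ-trans (≈ᴹ-sym (*ₗ-assoc a _ s)) (≈ᴹ-trans (*ₗ-congʳ (*-comm a _)) (*ₗ-assoc _ a s))

    contractᶠ-∧-cong : ∀ {n} v {s t : ⋀ᶜ (suc n)} → s ≈ᴹ t → contractᶠ s ≈ᴹ contractᶠ t →
                       contractᶠ (v ∧ s) ≈ᴹ contractᶠ (v ∧ t)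
    contractᶠ-∧-cong v {s} {t} s≈t Ks≈Kt = ≈ᴹ-trans (contractᶠ-∧ v s) (≈ᴹ-trans
      (+ᴹ-cong (*ₗ-congˡ s≈t) (-ᴹ‿cong (Lin.⟦⟧-cong (v∧ v _) Ks≈Kt))) (≈ᴹ-sym (contractᶠ-∧ v t)))

    -- This is the antiderivation rule applied to v ∧ vs = 0, but the vanishing of ι_φ(v ∧ vs) is
    -- what it serves to prove. Hence the recursion on the position of v: at the head v ∧ u
    -- vanishes, and further in v is moved past u.
    ∧-contract : ∀ {n} v (vs : Vec M.Carrierᴹ (suc n)) j → v M.≈ᴹ lookup vs j →
                 v ∧ contractᶠ ⟨ vs ⟩ ≈ᴹ ∣φ∣ v ⊙ ⟨ vs ⟩
    ∧-contract v (u ∷ []) 0F v≈u = begin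
      ∣φ∣ u ⊙ ⟨ v ∷ [] ⟩   ≈⟨ *ₗ-cong (φ.⟦⟧-cong (M.≈ᴹ-sym v≈u)) (rel (multilinear (congruent (v≈u ∷ [])))) ⟩
      ∣φ∣ v ⊙ ⟨ u ∷ [] ⟩   ∎
    ∧-contract v (u ∷ us@(_ ∷ _)) 0F v≈u = begin
      (∣φ∣ u ⊙ ⟨ v ∷ us ⟩) ⊕ (⊖ (v ∧ u ∧ contractᶠ ⟨ us ⟩))
        ≈⟨ +ᴹ-cong (*ₗ-cong (φ.⟦⟧-cong (M.≈ᴹ-sym v≈u)) (Lin.⟦⟧-cong (∧x ⟨ us ⟩) v≈u))
             (-ᴹ‿cong (≈ᴹ-trans (Lin.⟦⟧-cong (∧x (u ∧ contractᶠ ⟨ us ⟩)) v≈u) (∧-square u _))) ⟩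
      (∣φ∣ v ⊙ ⟨ u ∷ us ⟩) ⊕ (⊖ 𝟘)
        ≈⟨ ≈ᴹ-trans (+ᴹ-congˡ -ᴹ0≈0) (+ᴹ-identityʳ _) ⟩
      ∣φ∣ v ⊙ ⟨ u ∷ us ⟩ ∎
    ∧-contract v (u ∷ us@(_ ∷ _)) (suc j) v≈ = begin
      (∣φ∣ u ⊙ ⟨ v ∷ us ⟩) ⊕ (⊖ (v ∧ u ∧ contractᶠ ⟨ us ⟩))
        ≈⟨ +ᴹ-cong (*ₗ-congˡ (rel (repeated (v ∷ us) 0F (suc j) (λ ()) v≈)))
             (≈ᴹ-sym (∧-anticommute u v _)) ⟩
      (∣φ∣ u ⊙ 𝟘) ⊕ (u ∧ v ∧ contractᶠ ⟨ us ⟩)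
        ≈⟨ ≈ᴹ-trans (+ᴹ-congʳ (*ₗ-zeroʳ _)) (+ᴹ-identityˡ _) ⟩
      u ∧ v ∧ contractᶠ ⟨ us ⟩
        ≈⟨ Lin.⟦⟧-cong (v∧ u _) (∧-contract v us j v≈) ⟩
      ∣φ∣ v ⊙ ⟨ u ∷ us ⟩ ∎

    contract-repeated : ∀ {n} v (vs : Vec M.Carrierᴹ (suc n)) j → v M.≈ᴹ lookup vs j →
                        contractᶠ (v ∧ ⟨ vs ⟩) ≈ᴹ 𝟘
    contract-repeated v vs j v≈ = ≈ᴹ-trans (contractᶠ-∧ v ⟨ vs ⟩)
      (≈ᴹ-trans (+ᴹ-congˡ (-ᴹ‿cong (∧-contract v vs j v≈))) (-ᴹ‿inverseʳ _))

    -- Relations at the head hold by linearity of `contract`, and relations within the tail reduce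
    -- to one degree lower by the antiderivation rule. What remains is a repetition involving the
    -- head, which is `contract-repeated`.
    contractᶠ-resp : ∀ {n} {s t : ⋀ᶜ (suc n)} → AlternatingRel M s t → contractᶠ s ≈ᴹ contractᶠ t
    contractᶠ-resp (multilinear (congruent (v≈v′ ∷ []))) = Lin.⟦⟧-cong (contract []) v≈v′
    contractᶠ-resp (multilinear (congruent {v ∷ vs} {v′ ∷ vs′} (v≈v′ ∷ ps@(_ ∷ _)))) = ≈ᴹ-trans
      (Lin.⟦⟧-cong (contract vs) v≈v′)
      (contractᶠ-∧-cong v′ (rel (multilinear (congruent ps))) (contractᶠ-resp (multilinear (congruent ps))))
    contractᶠ-resp (multilinear (additive (v ∷ vs) 0F x y)) = Lin.+ᴹ-homo (contract vs) x y
    contractᶠ-resp (multilinear (additive (v ∷ vs@(_ ∷ _)) (suc i) x y)) =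
      contractᶠ-∧-cong v (rel r) (contractᶠ-resp r)
      where r = multilinear (additive vs i x y)
    contractᶠ-resp (multilinear (homogeneous (v ∷ vs) 0F a x)) = Lin.*ₗ-homo (contract vs) a x
    contractᶠ-resp (multilinear (homogeneous (v ∷ vs@(_ ∷ _)) (suc i) a x)) =
      contractᶠ-∧-cong v (rel r) (contractᶠ-resp r)
      where r = multilinear (homogeneous vs i a x)
    contractᶠ-resp (repeated (v ∷ vs) 0F 0F i≢j eq) = ⊥-elim (i≢j ≡.refl)
    contractᶠ-resp (repeated (v ∷ vs@(_ ∷ _)) 0F (suc j) i≢j eq) = contract-repeated v vs j eq
    contractᶠ-resp (repeated (v ∷ vs@(_ ∷ _)) (suc i) 0F i≢j eq) =
      contract-repeated v vs i (M.≈ᴹ-sym eq)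
    contractᶠ-resp (repeated (v ∷ vs@(_ ∷ _)) (suc i) (suc j) i≢j eq) =
      contractᶠ-∧-cong v (rel r) (contractᶠ-resp r)
      where r = repeated vs i j (i≢j ∘ ≡.cong suc) eq

    contractₗ : ∀ n → LinearMap (⋀ (suc n) M) (⋀ n M)
    contractₗ n = liftₗ (⋀ n M) contractᵛ contractᶠ-resp

  -- ⋀ with degrees shifted by two and padded by zero modules, so that contraction
  -- and its products are defined in every degree.
  B : ℕ → Module R (c ⊔ m) (c ⊔ ℓ ⊔ m ⊔ ℓm)
  B 0             = Zero.⟨module⟩
  B 1             = Zero.⟨module⟩
  B (suc (suc n)) = ⋀ n M

  ε : M.Carrierᴹ → ∀ n → LinearMap (B n) (B (1 ℕ.+ n))
  ε v 0             = zeroₗ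
  ε v 1             = zeroₗ
  ε v (suc (suc n)) = v∧ v n

  ι : LinearMap M scalars → ∀ n → LinearMap (B (1 ℕ.+ n)) (B n)
  ι φ 0             = zeroₗ
  ι φ 1             = zeroₗ
  ι φ (suc (suc n)) = Contraction.contractₗ φ n

  ∣_∣ : ℕ → Set (c ⊔ m)
  ∣ n ∣ = Module.Carrierᴹ (B n)

  ι-ε : ∀ φ v n (x : ∣ 1 ℕ.+ n ∣) → let module T = Module (B (1 ℕ.+ n)) in
    ⟦ ι φ (1 ℕ.+ n) ⟧ (⟦ ε v (1 ℕ.+ n) ⟧ x) T.≈ᴹ ⟦ φ ⟧ v T.*ₗ x T.+ᴹ T.-ᴹ ⟦ ε v n ⟧ (⟦ ι φ n ⟧ x)
  ι-ε φ v 0 x = _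
  -- Here x has exterior degree zero, below the range of `contractᶠ-∧`. The second term passes
  -- through the zero module and vanishes, so only the pairing of φ with v survives.
  ι-ε φ v 1 x = agree-on-generators
    (Contraction.contractₗ φ 0 ∘ₗ v∧ v 0) (⟦ φ ⟧ v ·ₗ idₗ +ₗ (-ₗ zeroₗ))
    (λ { [] → ≈ᴹ-sym (≈ᴹ-trans (+ᴹ-congˡ -ᴹ0≈0) (+ᴹ-identityʳ _)) }) x
  ι-ε φ v (suc (suc n)) x = Contraction.contractᶠ-∧ φ v x

  ε-anticommute : ∀ u v n (x : ∣ n ∣) → let module T = Module (B (2 ℕ.+ n)) in
    ⟦ ε u (1 ℕ.+ n) ⟧ (⟦ ε v n ⟧ x) T.≈ᴹ T.-ᴹ ⟦ ε v (1 ℕ.+ n) ⟧ (⟦ ε u n ⟧ x)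
  ε-anticommute u v 0 x             = ≈ᴹ-sym -ᴹ0≈0
  ε-anticommute u v 1 x             = ≈ᴹ-sym -ᴹ0≈0
  ε-anticommute u v (suc (suc n)) x = ∧-anticommute u v x

  -- On v ∧ y the composite is ψ(v) ι_φ y - φ(v) ι_ψ y + v ∧ ι_φ ι_ψ y. The first two terms are
  -- antisymmetric in φ and ψ together, the last by induction on the degree.
  ι-anticommute : ∀ φ ψ n (x : ∣ 2 ℕ.+ n ∣) → let module T = Module (B n) in
    ⟦ ι φ n ⟧ (⟦ ι ψ (1 ℕ.+ n) ⟧ x) T.≈ᴹ T.-ᴹ ⟦ ι ψ n ⟧ (⟦ ι φ (1 ℕ.+ n) ⟧ x)
  ι-anticommute φ ψ 0 x = _
  ι-anticommute φ ψ 1 x = _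
  ι-anticommute φ ψ (suc (suc k)) = agree-on-generators
    (ι φ (2 ℕ.+ k) ∘ₗ ι ψ (3 ℕ.+ k)) (-ₗ (ι ψ (2 ℕ.+ k) ∘ₗ ι φ (3 ℕ.+ k)))
    (step (ι-anticommute φ ψ (suc k)))
    where
    p q : LinearMap M scalars → LinearMap M scalars → M.Carrierᴹ → Vec M.Carrierᴹ (suc k) → ⋀ᶜ k
    p φ ψ v vs = ⟦ ψ ⟧ v ⊙ ⟦ ι φ (2 ℕ.+ k) ⟧ ⟨ vs ⟩
    q φ ψ v vs = ⟦ ε v (1 ℕ.+ k) ⟧ (⟦ ι φ (1 ℕ.+ k) ⟧ (⟦ ι ψ (2 ℕ.+ k) ⟧ ⟨ vs ⟩))
    ιι-∧ : ∀ φ ψ v (y : ⋀ᶜ (suc k)) →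
      ⟦ ι φ (2 ℕ.+ k) ⟧ (⟦ ι ψ (3 ℕ.+ k) ⟧ (v ∧ y)) ≈ᴹ
      (⟦ ψ ⟧ v ⊙ ⟦ ι φ (2 ℕ.+ k) ⟧ y) ⊕ ((⊖ (⟦ φ ⟧ v ⊙ ⟦ ι ψ (2 ℕ.+ k) ⟧ y)) ⊕
        ⟦ ε v (1 ℕ.+ k) ⟧ (⟦ ι φ (1 ℕ.+ k) ⟧ (⟦ ι ψ (2 ℕ.+ k) ⟧ y)))
    ιι-∧ φ ψ v y = begin
      ⟦ ι φ (2 ℕ.+ k) ⟧ (⟦ ι ψ (3 ℕ.+ k) ⟧ (v ∧ y))
        ≈⟨ Lin.⟦⟧-cong (ι φ (2 ℕ.+ k)) (ι-ε ψ v (2 ℕ.+ k) y) ⟩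
      ⟦ ι φ (2 ℕ.+ k) ⟧ ((⟦ ψ ⟧ v ⊙ y) ⊕ (⊖ (v ∧ ⟦ ι ψ (2 ℕ.+ k) ⟧ y)))
        ≈⟨ +ᴹ-congˡ (-ᴹ‿cong (ι-ε φ v (1 ℕ.+ k) (⟦ ι ψ (2 ℕ.+ k) ⟧ y))) ⟩
      (⟦ ψ ⟧ v ⊙ ⟦ ι φ (2 ℕ.+ k) ⟧ y) ⊕ (⊖ ((⟦ φ ⟧ v ⊙ ⟦ ι ψ (2 ℕ.+ k) ⟧ y) ⊕
        (⊖ ⟦ ε v (1 ℕ.+ k) ⟧ (⟦ ι φ (1 ℕ.+ k) ⟧ (⟦ ι ψ (2 ℕ.+ k) ⟧ y)))))
        ≈⟨ +ᴹ-congˡ (≈ᴹ-trans (≈ᴹ-sym (-ᴹ-+ᴹ-comm _ _)) (+ᴹ-congˡ (-ᴹ-involutive _))) ⟩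
      (⟦ ψ ⟧ v ⊙ ⟦ ι φ (2 ℕ.+ k) ⟧ y) ⊕ ((⊖ (⟦ φ ⟧ v ⊙ ⟦ ι ψ (2 ℕ.+ k) ⟧ y)) ⊕
        ⟦ ε v (1 ℕ.+ k) ⟧ (⟦ ι φ (1 ℕ.+ k) ⟧ (⟦ ι ψ (2 ℕ.+ k) ⟧ y))) ∎
    step : (∀ y → Module._≈ᴹ_ (B (suc k)) (⟦ ι φ (1 ℕ.+ k) ⟧ (⟦ ι ψ (2 ℕ.+ k) ⟧ y))
                     (Module.-ᴹ_ (B (suc k)) (⟦ ι ψ (1 ℕ.+ k) ⟧ (⟦ ι φ (2 ℕ.+ k) ⟧ y)))) →
           ∀ vs → ⟦ ι φ (2 ℕ.+ k) ⟧ (⟦ ι ψ (3 ℕ.+ k) ⟧ ⟨ vs ⟩) ≈ᴹ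
                  ⊖ ⟦ ι ψ (2 ℕ.+ k) ⟧ (⟦ ι φ (3 ℕ.+ k) ⟧ ⟨ vs ⟩)
    step ih (v ∷ vs) = begin
      ⟦ ι φ (2 ℕ.+ k) ⟧ (⟦ ι ψ (3 ℕ.+ k) ⟧ (v ∧ ⟨ vs ⟩))
        ≈⟨ ιι-∧ φ ψ v ⟨ vs ⟩ ⟩
      p φ ψ v vs ⊕ ((⊖ p ψ φ v vs) ⊕ q φ ψ v vs)
        ≈⟨ +ᴹ-congˡ (+ᴹ-congˡ (≈ᴹ-trans (Lin.⟦⟧-cong (ε v (1 ℕ.+ k)) (ih ⟨ vs ⟩))
             (Lin.-ᴹ-homo (ε v (1 ℕ.+ k)) _))) ⟩
      p φ ψ v vs ⊕ ((⊖ p ψ φ v vs) ⊕ (⊖ q ψ φ v vs))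
        ≈⟨ +ᴹ-cong (≈ᴹ-sym (-ᴹ-involutive _)) (+ᴹ-comm _ _) ⟩
      (⊖ ⊖ p φ ψ v vs) ⊕ ((⊖ q ψ φ v vs) ⊕ (⊖ p ψ φ v vs))
        ≈⟨ ≈ᴹ-trans (≈ᴹ-sym (+ᴹ-assoc _ _ _)) (+ᴹ-comm _ _) ⟩
      (⊖ p ψ φ v vs) ⊕ ((⊖ ⊖ p φ ψ v vs) ⊕ (⊖ q ψ φ v vs))
        ≈⟨ ≈ᴹ-trans (+ᴹ-congˡ (-ᴹ-+ᴹ-comm _ _)) (-ᴹ-+ᴹ-comm _ _) ⟩
      ⊖ (p ψ φ v vs ⊕ ((⊖ p φ ψ v vs) ⊕ q ψ φ v vs))
        ≈⟨ -ᴹ‿cong (ιι-∧ ψ φ v ⟨ vs ⟩) ⟨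
      ⊖ ⟦ ι ψ (2 ℕ.+ k) ⟧ (⟦ ι φ (3 ℕ.+ k) ⟧ (v ∧ ⟨ vs ⟩)) ∎

  module _ {d : ℕ} (E : Word d → M.Carrierᴹ) (E* : Word d → LinearMap M scalars)
           (expansion : ∀ v → Sum.∑ M (λ a → ⟦ E* a ⟧ v M.*ₗ E a) M.≈ᴹ v) where

    -- The operator Σ_a E_a ∧ ι_a is a derivation: the sign from contracting past v and the sign
    -- from moving E_a past v cancel. By `expansion` it fixes every vector, so each factor of a
    -- wedge contributes 1.
    euler : ∀ n (x : ∣ 2 ℕ.+ n ∣) → let module T = Module (B (2 ℕ.+ n)) in
      Sum.∑ (B (2 ℕ.+ n)) (λ a → ⟦ ε (E a) (1 ℕ.+ n) ⟧ (⟦ ι (E* a) (1 ℕ.+ n) ⟧ x)) T.≈ᴹ nat n T.*ₗ x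
    euler zero    x = ≈ᴹ-trans (Sum.∑-0 (⋀ 0 M) {d} (λ _ → ≈ᴹ-refl)) (≈ᴹ-sym (*ₗ-zeroˡ x))
    euler (suc k) = agree-on-generators
      (∑ₗ λ a → ε (E a) (2 ℕ.+ k) ∘ₗ ι (E* a) (2 ℕ.+ k)) (nat (suc k) ·ₗ idₗ)
      (step (euler k))
      where
      open Sum (⋀ (suc k) M)
      P : ⋀ᶜ k → Word d → ⋀ᶜ k
      P y a = ⟦ ε (E a) (1 ℕ.+ k) ⟧ (⟦ ι (E* a) (1 ℕ.+ k) ⟧ y)
      expand : ∀ v (y : ⋀ᶜ k) → ∑ (λ a → ⟦ E* a ⟧ v ⊙ (E a ∧ y)) ≈ᴹ v ∧ y
      expand v y = begin
        ∑ (λ a → ⟦ E* a ⟧ v ⊙ (E a ∧ y))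
          ≈⟨ ∑-cong (λ a → Lin.*ₗ-homo (∧x y) (⟦ E* a ⟧ v) (E a)) ⟨
        ∑ (λ a → (⟦ E* a ⟧ v M.*ₗ E a) ∧ y)
          ≈⟨ ∑-homo (∧x y) (λ a → ⟦ E* a ⟧ v M.*ₗ E a) ⟨
        Sum.∑ M (λ a → ⟦ E* a ⟧ v M.*ₗ E a) ∧ y
          ≈⟨ Lin.⟦⟧-cong (∧x y) (expansion v) ⟩
        v ∧ y ∎
      term : ∀ v (y : ⋀ᶜ k) a → E a ∧ ⟦ ι (E* a) (2 ℕ.+ k) ⟧ (v ∧ y) ≈ᴹ
                                (⟦ E* a ⟧ v ⊙ (E a ∧ y)) ⊕ (v ∧ P y a)
      term v y a = begin
        E a ∧ ⟦ ι (E* a) (2 ℕ.+ k) ⟧ (v ∧ y)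
          ≈⟨ Lin.⟦⟧-cong (v∧ (E a) k) (ι-ε (E* a) v (1 ℕ.+ k) y) ⟩
        E a ∧ ((⟦ E* a ⟧ v ⊙ y) ⊕ (⊖ ⟦ ε v (1 ℕ.+ k) ⟧ (⟦ ι (E* a) (1 ℕ.+ k) ⟧ y)))
          ≈⟨ +ᴹ-congˡ (-ᴹ‿cong (ε-anticommute (E a) v (1 ℕ.+ k) (⟦ ι (E* a) (1 ℕ.+ k) ⟧ y))) ⟩
        (⟦ E* a ⟧ v ⊙ (E a ∧ y)) ⊕ (⊖ ⊖ (v ∧ P y a))
          ≈⟨ +ᴹ-congˡ (-ᴹ-involutive _) ⟩
        (⟦ E* a ⟧ v ⊙ (E a ∧ y)) ⊕ (v ∧ P y a) ∎
      step : (∀ y → Sum.∑ (⋀ k M) (P y) ≈ᴹ nat k ⊙ y) →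
             ∀ vs → ∑ (λ a → E a ∧ ⟦ ι (E* a) (2 ℕ.+ k) ⟧ ⟨ vs ⟩) ≈ᴹ nat (suc k) ⊙ ⟨ vs ⟩
      step ih (v ∷ vs) = begin
        ∑ (λ a → E a ∧ ⟦ ι (E* a) (2 ℕ.+ k) ⟧ (v ∧ ⟨ vs ⟩))
          ≈⟨ ∑-cong (λ a → term v ⟨ vs ⟩ a) ⟩
        ∑ (λ a → (⟦ E* a ⟧ v ⊙ (E a ∧ ⟨ vs ⟩)) ⊕ (v ∧ P ⟨ vs ⟩ a))
          ≈⟨ ∑-+ (λ a → ⟦ E* a ⟧ v ⊙ (E a ∧ ⟨ vs ⟩)) (λ a → v ∧ P ⟨ vs ⟩ a) ⟩
        ∑ (λ a → ⟦ E* a ⟧ v ⊙ (E a ∧ ⟨ vs ⟩)) ⊕ ∑ (λ a → v ∧ P ⟨ vs ⟩ a)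
          ≈⟨ +ᴹ-cong (expand v ⟨ vs ⟩) (≈ᴹ-sym (∑-homo (v∧ v k) (P ⟨ vs ⟩))) ⟩
        ⟨ v ∷ vs ⟩ ⊕ (v ∧ Sum.∑ (⋀ k M) (P ⟨ vs ⟩))
          ≈⟨ +ᴹ-cong (≈ᴹ-sym (*ₗ-identityˡ _)) (Lin.⟦⟧-cong (v∧ v k) (ih ⟨ vs ⟩)) ⟩
        (1# ⊙ ⟨ v ∷ vs ⟩) ⊕ (nat k ⊙ ⟨ v ∷ vs ⟩)
          ≈⟨ *ₗ-distribʳ _ 1# (nat k) ⟨
        nat (suc k) ⊙ ⟨ v ∷ vs ⟩ ∎

-- The Cayley form

module TensorPower {c ℓ : Level} (R : CommutativeRing c ℓ) where

  open CommutativeRing R renaming (Carrier to A)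
  open RingProperties ring using (-‿involutive; -‿distribˡ-*; -‿distribʳ-*)
  open CommutativeSemigroupProperties *-commutativeSemigroup using () renaming (x∙yz≈y∙xz to *-swapˡ)
  open LinearMaps R
  open FreeModules R
  open Multilinear R hiding (L)
  open LinearMap using (⟦_⟧)

  private
    module _ {d : ℕ} where
      open Mod (V d) public hiding (Carrierᴹ)

  coordinate : Fin 2 → A × A → A
  coordinate 0F = proj₁
  coordinate 1F = proj₂

  coordinates : ∀ {d} → Word d → Vec (A × A) d → A
  coordinates []      []       = 1#
  coordinates (i ∷ a) (u ∷ us) = coordinate i u * coordinates a us

  coordinates-resp : ∀ {d} (a : Word d) {s t} → MultilinearRel R² s t →
                     lift scalars (coordinates a) s ≈ lift scalars (coordinates a) t
  coordinates-resp [] (congruent []) = refl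
  coordinates-resp (0F ∷ a) (congruent ((p , q) ∷ ps)) = *-cong p (coordinates-resp a (congruent ps))
  coordinates-resp (1F ∷ a) (congruent ((p , q) ∷ ps)) = *-cong q (coordinates-resp a (congruent ps))
  coordinates-resp (0F ∷ a) (additive (u ∷ us) 0F x y) = distribʳ _ _ _
  coordinates-resp (1F ∷ a) (additive (u ∷ us) 0F x y) = distribʳ _ _ _
  coordinates-resp (i ∷ a) (additive (u ∷ us) (suc j) x y) =
    trans (*-congˡ (coordinates-resp a (additive us j x y))) (distribˡ _ _ _)
  coordinates-resp (0F ∷ a) (homogeneous (u ∷ us) 0F r x) = *-assoc _ _ _
  coordinates-resp (1F ∷ a) (homogeneous (u ∷ us) 0F r x) = *-assoc _ _ _
  coordinates-resp (i ∷ a) (homogeneous (u ∷ us) (suc j) r x) =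
    trans (*-congˡ (coordinates-resp a (homogeneous us j r x))) (*-swapˡ _ _ _)

  E* : ∀ {d} → Word d → LinearMap (V d) scalars
  E* a = liftₗ scalars (coordinates a) (coordinates-resp a)

  E : ∀ {d} → Word d → Module.Carrierᴹ (V d)
  E a = ⟨ Vec.map e a ⟩

  E*-E-diagonal : ∀ {d} (a : Word d) → ⟦ E* a ⟧ (E a) ≈ 1#
  E*-E-diagonal []       = refl
  E*-E-diagonal (0F ∷ a) = trans (*-identityˡ _) (E*-E-diagonal a)
  E*-E-diagonal (1F ∷ a) = trans (*-identityˡ _) (E*-E-diagonal a)

  module _ {n ℓn : Level} (N : Module R n ℓn) where

    private module N = Mod N
    open Sum N

    E*-E-select : ∀ {d} b (f : Word d → N.Carrierᴹ) →
                  ∑ (λ a → ⟦ E* b ⟧ (E a) N.*ₗ f a) N.≈ᴹ f b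
    E*-E-select []            f = N.*ₗ-identityˡ (f [])
    E*-E-select {suc d} (i ∷ b) f = cases i
      where
      term : Fin 2 → Word d → N.Carrierᴹ
      term j a = coordinates b (Vec.map e a) N.*ₗ f (j ∷ a)
      1-terms : ∀ j → ∑ (λ a → (1# * coordinates b (Vec.map e a)) N.*ₗ f (j ∷ a)) N.≈ᴹ f (j ∷ b)
      1-terms j = N.≈ᴹ-trans
        (∑-cong {g = term j} λ a → N.*ₗ-congʳ (*-identityˡ (coordinates b (Vec.map e a))))
        (E*-E-select b (f ∘ (j ∷_)))
      0-terms : ∀ j → ∑ (λ a → (0# * coordinates b (Vec.map e a)) N.*ₗ f (j ∷ a)) N.≈ᴹ N.0ᴹ
      0-terms j = ∑-0 λ a → N.≈ᴹ-trans (N.*ₗ-congʳ (zeroˡ (coordinates b (Vec.map e a))))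
        (N.*ₗ-zeroˡ (f (j ∷ a)))
      cases : ∀ i → ∑ (λ a → ⟦ E* (i ∷ b) ⟧ (E a) N.*ₗ f a) N.≈ᴹ f (i ∷ b)
      cases 0F = N.≈ᴹ-trans (N.+ᴹ-cong (1-terms 0F) (0-terms 1F)) (N.+ᴹ-identityʳ _)
      cases 1F = N.≈ᴹ-trans (N.+ᴹ-cong (0-terms 0F) (1-terms 1F)) (N.+ᴹ-identityˡ _)

    sumᴸ : ∀ {x} {X : Set x} → (X → N.Carrierᴹ) → List X → N.Carrierᴹ
    sumᴸ f xs = List.foldr N._+ᴹ_ N.0ᴹ (List.map f xs)

    sumᴸ-++ : ∀ {x} {X : Set x} (f : X → N.Carrierᴹ) xs ys →
              sumᴸ f (xs List.++ ys) N.≈ᴹ sumᴸ f xs N.+ᴹ sumᴸ f ys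
    sumᴸ-++ f []       ys = N.≈ᴹ-sym (N.+ᴹ-identityˡ _)
    sumᴸ-++ f (x ∷ xs) ys = N.≈ᴹ-trans (N.+ᴹ-congˡ (sumᴸ-++ f xs ys)) (N.≈ᴹ-sym (N.+ᴹ-assoc _ _ _))

    sumᴸ-map : ∀ {x y} {X : Set x} {Y : Set y} (f : Y → N.Carrierᴹ) (g : X → Y) xs →
               sumᴸ f (List.map g xs) ≡ sumᴸ (f ∘ g) xs
    sumᴸ-map f g xs = ≡.cong (List.foldr N._+ᴹ_ N.0ᴹ) (≡.sym (List.map-∘ xs))

  tensor : ∀ u d → LinearMap (V d) (V (suc d))
  tensor u d = linear (V d) (V (suc d)) (mapFree (u ∷_)) (mapFree-cong (u ∷_) resp)
    (λ _ _ → ≈ᴹ-refl) (λ _ _ → ≈ᴹ-refl)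
    where
    resp : ∀ {s t} → MultilinearRel R² s t → mapFree {Y = Vec (A × A) (suc d)} (u ∷_) s ≈ᴹ mapFree (u ∷_) t
    resp (congruent ps)         = rel (congruent (Module.≈ᴹ-refl R² ∷ ps))
    resp (additive us i x y)    = rel (additive (u ∷ us) (suc i) x y)
    resp (homogeneous us i r x) = rel (homogeneous (u ∷ us) (suc i) r x)

  expansion-⟨⟩ : ∀ {d} (us : Vec (A × A) d) → Sum.∑ (V d) (λ a → coordinates a us ⊙ E a) ≈ᴹ ⟨ us ⟩
  expansion-⟨⟩ []                 = ⊙-identityˡ _
  expansion-⟨⟩ {suc d} ((x , y) ∷ us) = begin
    ∑ (λ a → (x * coordinates a us) ⊙ E (0F ∷ a)) ⊕ ∑ (λ a → (y * coordinates a us) ⊙ E (1F ∷ a))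
      ≈⟨ +ᴹ-cong (factor x 0F) (factor y 1F) ⟩
    x ⊙ ⟨ e 0F ∷ us ⟩ ⊕ y ⊙ ⟨ e 1F ∷ us ⟩
      ≈⟨ +ᴹ-cong (rel (homogeneous (e 0F ∷ us) 0F x (e 0F))) (rel (homogeneous (e 1F ∷ us) 0F y (e 1F))) ⟨
    ⟨ x R².*ₗ e 0F ∷ us ⟩ ⊕ ⟨ y R².*ₗ e 1F ∷ us ⟩
      ≈⟨ rel (additive (e 0F ∷ us) 0F (x R².*ₗ e 0F) (y R².*ₗ e 1F)) ⟨
    ⟨ (x R².*ₗ e 0F) R².+ᴹ (y R².*ₗ e 1F) ∷ us ⟩
      ≈⟨ rel (congruent ((x-eq , y-eq) ∷ Pointwise.refl R².≈ᴹ-refl)) ⟩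
    ⟨ (x , y) ∷ us ⟩ ∎
    where
    module R² = Module R²
    open Sum (V (suc d))
    x-eq : x * 1# + y * 0# ≈ x
    x-eq = trans (+-cong (*-identityʳ x) (zeroʳ y)) (+-identityʳ x)
    y-eq : x * 0# + y * 1# ≈ y
    y-eq = trans (+-cong (zeroʳ x) (*-identityʳ y)) (+-identityˡ y)
    factor : ∀ r i → ∑ (λ a → (r * coordinates a us) ⊙ E (i ∷ a)) ≈ᴹ r ⊙ ⟨ e i ∷ us ⟩
    factor r i = begin
      ∑ (λ a → (r * coordinates a us) ⊙ E (i ∷ a))
        ≈⟨ ∑-cong (λ a → *ₗ-assoc r (coordinates a us) (E (i ∷ a))) ⟩
      ∑ (λ a → r ⊙ coordinates a us ⊙ E (i ∷ a))
        ≈⟨ ∑-* r (λ a → coordinates a us ⊙ E (i ∷ a)) ⟩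
      r ⊙ ∑ (λ a → coordinates a us ⊙ E (i ∷ a))
        ≈⟨ *ₗ-congˡ (∑-homo (tensor (e i) d) (λ a → coordinates a us ⊙ E a)) ⟨
      r ⊙ ⟦ tensor (e i) d ⟧ (Sum.∑ (V d) (λ a → coordinates a us ⊙ E a))
        ≈⟨ *ₗ-congˡ (Lin.⟦⟧-cong (tensor (e i) d) (expansion-⟨⟩ us)) ⟩
      r ⊙ ⟨ e i ∷ us ⟩ ∎

  expansion : ∀ {d} (v : Module.Carrierᴹ (V d)) → Sum.∑ (V d) (λ a → ⟦ E* a ⟧ v ⊙ E a) ≈ᴹ v
  expansion {d} = agree-on-generators (∑ₗ λ a → E* a ▹ E a) (idₗ {M = V d}) expansion-⟨⟩

  s : ∀ {d} → Word d → A
  s []       = 1#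
  s (0F ∷ a) = s a
  s (1F ∷ a) = - s a

  -- `s` is (-1) to the number of letters `1F`, so complementing a word multiplies it by (-1)^d.
  -- Letters are consumed in pairs, in step with the recursion of `parity`.
  s-conj : ∀ {d} → parity d ≡ 1ℙ → (a : Word d) → s (conj a) ≈ - s a
  s-conj {1} odd (0F ∷ []) = refl
  s-conj {1} odd (1F ∷ []) = sym (-‿involutive 1#)
  s-conj {suc (suc d)} odd (0F ∷ 0F ∷ a) = trans (-‿involutive _) (s-conj odd a)
  s-conj {suc (suc d)} odd (0F ∷ 1F ∷ a) = -‿cong (s-conj odd a)
  s-conj {suc (suc d)} odd (1F ∷ 0F ∷ a) = -‿cong (s-conj odd a)
  s-conj {suc (suc d)} odd (1F ∷ 1F ∷ a) = trans (s-conj odd a) (-‿cong (sym (-‿involutive _)))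

  s-square : ∀ {d} (a : Word d) → s a * s a ≈ 1#
  s-square []       = *-identityˡ 1#
  s-square (0F ∷ a) = s-square a
  s-square (1F ∷ a) = trans (sym (-‿distribˡ-* (s a) (- s a)))
    (trans (-‿cong (sym (-‿distribʳ-* (s a) (s a)))) (trans (-‿involutive _) (s-square a)))

  -- The element of S₂ that sends `0F` to the given letter. A tuple of permutations thus becomes a
  -- word a whose two tensors are `E a` and `E (conj a)`.
  permutation : Fin 2 → Permutation′ 2
  permutation 0F = idₚ
  permutation 1F = transpose 0F 1F

  inversions-cong : ∀ {k} {π ρ : Permutation′ k} → (∀ i → π ⟨$⟩ʳ i ≡ ρ ⟨$⟩ʳ i) →
                    inversions π ≡ inversions ρ
  inversions-cong {k} π≗ρ = ≡.cong List.length (List.filter-≐ _ _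
    ( (λ {(i , j)} (i<j , lt) → i<j , ≡.subst₂ Fin._<_ (π≗ρ j) (π≗ρ i) lt)
    , (λ {(i , j)} (i<j , lt) → i<j , ≡.subst₂ Fin._<_ (≡.sym (π≗ρ j)) (≡.sym (π≗ρ i)) lt))
    (List.cartesianProduct (List.allFin k) (List.allFin k)))

  -- A product of permutations is identified with an element of S₂ only through its values, not as a
  -- record. Pairing this pointwise description with the sign lets one more transposition act by
  -- exchanging the two cases.
  data Sign (π : Permutation′ 2) (r : A) : Set ℓ where
    even : (∀ i → π ⟨$⟩ʳ i ≡ i) → r ≈ 1# → Sign π r
    odd  : (∀ i → π ⟨$⟩ʳ i ≡ opposite i) → r ≈ - 1# → Sign π r

  swap≗opposite : ∀ (i : Fin 2) → transpose 0F 1F ⟨$⟩ʳ i ≡ opposite i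
  swap≗opposite 0F = ≡.refl
  swap≗opposite 1F = ≡.refl

  Sign-sgn : ∀ {π r} → Sign π r → sgn π ≈ r
  Sign-sgn {π} (even π≗ r≈1)
    rewrite inversions-cong {π = π} {idₚ {2}} π≗ = sym r≈1
  Sign-sgn {π} (odd π≗ r≈-1)
    rewrite inversions-cong {π = π} {transpose {2} 0F 1F} (λ i → ≡.trans (π≗ i) (≡.sym (swap≗opposite i))) =
      trans (*-identityʳ _) (sym r≈-1)

  Sign-∏ : ∀ {d} (a : Word d) → Sign (∏ₚ (Vec.map permutation a)) (s a)
  Sign-∏ [] = even (λ _ → ≡.refl) refl
  Sign-∏ (0F ∷ a) with Sign-∏ a
  ... | even π≗ r = even π≗ r
  ... | odd  π≗ r = odd π≗ r
  Sign-∏ (1F ∷ a) with Sign-∏ a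
  ... | even π≗ r = odd (λ i → ≡.trans (swap≗opposite (∏ₚ (Vec.map permutation a) ⟨$⟩ʳ i)) (≡.cong opposite (π≗ i))) (-‿cong r)
  ... | odd  π≗ r = even (λ i → ≡.trans (swap≗opposite (∏ₚ (Vec.map permutation a) ⟨$⟩ʳ i))
                        (≡.trans (≡.cong opposite (π≗ i)) (Fin.opposite-involutive i)))
                      (trans (-‿cong r) (-‿involutive 1#))

  e⊗-0F : ∀ {d} (a : Word d) → e⊗ (Vec.map permutation a) 0F ≡ E a
  e⊗-0F a = ≡.cong ⟨_⟩ (≡.trans (≡.sym (Vec.map-∘ _ permutation a)) (Vec.map-cong (λ { 0F → ≡.refl ; 1F → ≡.refl }) a))

  e⊗-1F : ∀ {d} (a : Word d) → e⊗ (Vec.map permutation a) 1F ≡ E (conj a)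
  e⊗-1F a = ≡.cong ⟨_⟩ (≡.trans (≡.sym (Vec.map-∘ _ permutation a))
    (≡.trans (Vec.map-cong (λ { 0F → ≡.refl ; 1F → ≡.refl }) a) (Vec.map-∘ e opposite a)))

  module _ {n ℓn : Level} (N : Module R n ℓn) where

    private module N = Mod N
    open Sum N

    sumᴸ-tuples : ∀ d (f : Vec (Permutation′ 2) d → N.Carrierᴹ) →
                  sumᴸ N f (tuples S₂ d) N.≈ᴹ ∑ (f ∘ Vec.map permutation)
    sumᴸ-tuples zero    f = N.+ᴹ-identityʳ _
    sumᴸ-tuples (suc d) f = N.begin
      sumᴸ N f (with-id List.++ (with-swap List.++ []))
        N.≈⟨ sumᴸ-++ N f with-id (with-swap List.++ []) ⟩
      sumᴸ N f with-id N.+ᴹ sumᴸ N f (with-swap List.++ [])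
        N.≡⟨ ≡.cong₂ (λ xs ys → xs N.+ᴹ sumᴸ N f ys) (sumᴸ-map N f (idₚ ∷_) (tuples S₂ d))
               (List.++-identityʳ with-swap) ⟩
      sumᴸ N (f ∘ (idₚ ∷_)) (tuples S₂ d) N.+ᴹ sumᴸ N f with-swap
        N.≡⟨ ≡.cong (sumᴸ N (f ∘ (idₚ ∷_)) (tuples S₂ d) N.+ᴹ_)
               (sumᴸ-map N f (transpose 0F 1F ∷_) (tuples S₂ d)) ⟩
      sumᴸ N (f ∘ (idₚ ∷_)) (tuples S₂ d) N.+ᴹ sumᴸ N (f ∘ (transpose 0F 1F ∷_)) (tuples S₂ d)
        N.≈⟨ N.+ᴹ-cong (sumᴸ-tuples d (f ∘ (idₚ ∷_))) (sumᴸ-tuples d (f ∘ (transpose 0F 1F ∷_))) ⟩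
      ∑ (f ∘ Vec.map permutation) N.∎
      where
      with-id with-swap : List (Vec (Permutation′ 2) (suc d))
      with-id   = List.map (idₚ ∷_) (tuples S₂ d)
      with-swap = List.map (transpose 0F 1F ∷_) (tuples S₂ d)

  ω-expansion : ∀ d → Module._≈ᴹ_ (⋀ 2 (V d)) (ω d)
    (Sum.∑ (⋀ 2 (V d)) (λ a → s a ⊙ ⟨ E a ∷ E (conj a) ∷ [] ⟩))
  ω-expansion d = transitive
    (sumᴸ-tuples (⋀ 2 (V d)) d (λ πs → sgn (∏ₚ πs) ⊙ ⟨ e⊗ πs 0F ∷ e⊗ πs 1F ∷ [] ⟩))
    (Sum.∑-cong (⋀ 2 (V d)) λ a → ⊙-cong (Sign-sgn (Sign-∏ a))
      (≡.subst₂ (λ u v → Module._≈ᴹ_ (⋀ 2 (V d)) ⟨ e⊗ (Vec.map permutation a) 0F ∷ e⊗ (Vec.map permutation a) 1F ∷ [] ⟩ ⟨ u ∷ v ∷ [] ⟩)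
        (e⊗-0F a) (e⊗-1F a) (Module.≈ᴹ-refl (⋀ 2 (V d)))))

-- Full rank of multiplication by the Cayley form

module HardLefschetz {c ℓ : Level} (R : CommutativeRing c ℓ)
  (nat-inverse : LinearMaps.NatInvertible R) (d : ℕ) (d-odd : parity d ≡ 1ℙ) where

  open LinearMaps R
  open FreeModules R
  open Multilinear R hiding (L; FullRank)
  open LinearMap using (⟦_⟧)
  open TensorPower R
  open Exterior R (V d) hiding (_∧_)

  private
    module _ {n : ℕ} where
      open Mod (⋀ n (V d)) public hiding (Carrierᴹ)

  -- The last two placeholders are the triviality of `B 0` and `B 1`, which are zero modules.
  open Lefschetz.Fock R nat-inverse B d _ _
    (λ a → ε (E a)) (λ a → ι (E* a))
    (λ b a → ⟦ E* b ⟧ (E a)) E*-E-diagonal (λ {n} → E*-E-select (B n))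
    (λ a b → ι-ε (E* a) (E b))
    (λ a b → ι-anticommute (E* a) (E* b))
    (euler E E* expansion)
    s (s-conj d-odd) s-square

  Lω : ∀ n → LinearMap (⋀ n (V d)) (⋀ (2 ℕ.+ n) (V d))
  Lω = Multilinear.L R d

  ∑-∧ : ∀ {k n} (f : Word k → Module.Carrierᴹ (⋀ 2 (V d))) (x : Module.Carrierᴹ (⋀ n (V d))) →
        Sum.∑ (⋀ 2 (V d)) f ∧ x ≈ᴹ Sum.∑ (⋀ (2 ℕ.+ n) (V d)) (λ a → f a ∧ x)
  ∑-∧ {zero}  f x = ≈ᴹ-refl
  ∑-∧ {suc k} f x = +ᴹ-cong (∑-∧ (f ∘ (0F ∷_)) x) (∑-∧ (f ∘ (1F ∷_)) x)

  Lω≈raise : ∀ n x → ⟦ Lω n ⟧ x ≈ᴹ ⟦ raise (2 ℕ.+ n) ⟧ x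
  Lω≈raise n x = begin
    ω d ∧ x
      ≈⟨ ∧-congʳ (V d) 2 n (ω-expansion d) x ⟩
    Sum.∑ (⋀ 2 (V d)) (λ a → s a ⊙ ⟨ E a ∷ E (conj a) ∷ [] ⟩) ∧ x
      ≈⟨ ∑-∧ (λ a → s a ⊙ ⟨ E a ∷ E (conj a) ∷ [] ⟩) x ⟩
    Sum.∑ (⋀ (2 ℕ.+ n) (V d)) (λ a → s a ⊙ mapFree ((E a ∷ E (conj a) ∷ []) Vec.++_) x)
      ≈⟨ Sum.∑-cong (⋀ (2 ℕ.+ n) (V d)) (λ a → *ₗ-congˡ (agree-on-generators
           (wedge ⟨ E a ∷ E (conj a) ∷ [] ⟩ n) (v∧ (E a) (suc n) ∘ₗ v∧ (E (conj a)) n)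
           (λ _ → ≈ᴹ-refl) x)) ⟩
    ⟦ raise (2 ℕ.+ n) ⟧ x ∎

  -- Injectivity depends on the source degree n, surjectivity on the target degree n + 2. If 2n is
  -- at least 2^d, then 2(n + 2) exceeds 2^d, so the two ranges leave no gap around the middle.
  Lω-fullRank : ∀ n → Multilinear.FullRank R (Lω n)
  Lω-fullRank n with n ℕ.+ n ℕ.<? 2 ℕ.^ d
  ... | yes 2n<N = inj₁ λ {x} {y} Lx≈Ly → begin
    x                         ≈⟨ +ᴹ-identityʳ x ⟨
    x ⊕ 𝟘                     ≈⟨ +ᴹ-congˡ (-ᴹ‿inverseˡ y) ⟨
    x ⊕ ((⊖ y) ⊕ y)           ≈⟨ +ᴹ-assoc _ _ _ ⟨
    (x ⊕ (⊖ y)) ⊕ y           ≈⟨ +ᴹ-congʳ (raise-kernel n 2n<N (x ⊕ (⊖ y)) (begin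
      ⟦ raise (2 ℕ.+ n) ⟧ (x ⊕ (⊖ y))     ≈⟨ Lω≈raise n (x ⊕ (⊖ y)) ⟨
      ⟦ Lω n ⟧ (x ⊕ (⊖ y))                ≈⟨ Lin.+ᴹ-homo (Lω n) x (⊖ y) ⟩
      ⟦ Lω n ⟧ x ⊕ ⟦ Lω n ⟧ (⊖ y)         ≈⟨ +ᴹ-cong Lx≈Ly (Lin.-ᴹ-homo (Lω n) y) ⟩
      ⟦ Lω n ⟧ y ⊕ (⊖ ⟦ Lω n ⟧ y)         ≈⟨ -ᴹ‿inverseʳ _ ⟩
      𝟘                                   ∎)) ⟩
    𝟘 ⊕ y                     ≈⟨ +ᴹ-identityˡ y ⟩
    y                         ∎
  ... | no 2n≮N = inj₂ λ y → let x , Lx≈y = raise-preimage (2 ℕ.+ n) N<2n+4 y in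
    x , λ z≈x → ≈ᴹ-trans (Lin.⟦⟧-cong (Lω n) z≈x) (≈ᴹ-trans (Lω≈raise n x) Lx≈y)
    where
    N<2n+4 : 2 ℕ.^ d ℕ.< (2 ℕ.+ n) ℕ.+ (2 ℕ.+ n)
    N<2n+4 = ℕ.≤-<-trans (ℕ.≮⇒≥ 2n≮N) (ℕ.+-mono-<-≤ (ℕ.m<n+m n {2} (ℕ.s≤s ℕ.z≤n)) (ℕ.m≤n+m n 2))

-- Inverses of the positive integers in the complex numbers

open LinearMaps ℂ-commutativeRing using (nat; NatInvertible)

natℚ : ℕ → ℚ
natℚ zero    = 0ℚ
natℚ (suc k) = 1ℚ ℚ.+ natℚ k

natℚ-nonNegative : ∀ k → NonNegative (natℚ k)
natℚ-nonNegative zero    = _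
natℚ-nonNegative (suc k) = ℚ.nonNeg+nonNeg⇒nonNeg 1ℚ (natℚ k) {{natℚ-nonNegative k}}

natℚ-suc-positive : ∀ k → Positive (natℚ (suc k))
natℚ-suc-positive k = ℚ.pos+nonNeg⇒pos 1ℚ (natℚ k) {{natℚ-nonNegative k}}

ratℂ-+ : ∀ p q → ratℂ p +ℂ ratℂ q ≈ℂ ratℂ (p ℚ.+ q)
ratℂ-+ p q = mk≈ℂ (pointwise λ _ → ≡.refl) (pointwise λ _ → ≡.refl)

ratℂ-* : ∀ p q → ratℂ p *ℂ ratℂ q ≈ℂ ratℂ (p ℚ.* q)
ratℂ-* p q = mk≈ℂ
  (pointwise λ _ → ℚ.+-identityʳ (p ℚ.* q))
  (pointwise λ _ → ≡.cong₂ ℚ._+_ (ℚ.*-zeroʳ p) (ℚ.*-zeroˡ q))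

nat≈ratℂ : ∀ k → nat k ≈ℂ ratℂ (natℚ k)
nat≈ratℂ zero    = mk≈ℂ ≈ℝ-refl ≈ℝ-refl
nat≈ratℂ (suc k) = ≈ℂ-trans (+ℂ-cong (mk≈ℂ ≈ℝ-refl ≈ℝ-refl) (nat≈ratℂ k)) (ratℂ-+ 1ℚ (natℚ k))

-- The inverse is taken in ℚ, where positivity shows that the integer is nonzero, and is then
-- carried to ℂ as a constant sequence.
nat-inverse : NatInvertible
nat-inverse k = ratℂ q⁻¹ , ≈ℂ-trans (*ℂ-cong (mk≈ℂ ≈ℝ-refl ≈ℝ-refl) (nat≈ratℂ (suc k)))
  (≈ℂ-trans (ratℂ-* q⁻¹ q) (≡.subst (λ p → ratℂ (q⁻¹ ℚ.* q) ≈ℂ ratℂ p) (ℚ.*-inverseˡ q)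
    (mk≈ℂ ≈ℝ-refl ≈ℝ-refl)))
  where
  q = natℚ (suc k)
  instance
    q≢0 : ℚ.NonZero q
    q≢0 = ℚ.pos⇒nonZero q {{natℚ-suc-positive k}}
  q⁻¹ = ℚ.1/ q

corollary5p6 : ∀ (d : ℕ) → 3 ≤ d → parity d ≡ 1ℙ →
    ∀ (n : ℕ) → n ≤ 2 ^ d ∸ 2 → FullRank (L d n)
corollary5p6 d _ d-odd n _ = HardLefschetz.Lω-fullRank ℂ-commutativeRing nat-inverse d d-odd n
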